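{- Let $\mathcal X=([v],\{R_i\}_{i=0}^d)$ be a symmetric association scheme. Let $k$ be a positive integer and let $A$ be a $v\times v$ complex diagonalisable matrix such that (1) $D_A(k)=\{a,b\}$ with $a\neq b$, and (2) for each $i\in\{0,1\}$ there is a constant $c_i$ with $c_A(\alpha,k)=c_i$ for all $\alpha\in\binom{[v]}{i}$, and for each $j\in\{1,\dots,d\}$ there is a constant $c_2(j)$ with $c_A(\alpha,k)=c_2(j)$ for all $\alpha\in\tilde R_j$. Then the hypergraph $\mathfrak H_A(v,k,a)$ is a $\operatorname{PBIBD}(v,k;\lambda_1,\dots,\lambda_d)$ on $\mathcal X$ with $$\lambda_i=\frac{(-1)^k}{a-b}\bigl(c_0-2c_1+c_2(i)\bigr)-\frac{b}{a-b}\binom{v-2}{k-2}\qquad (i=1,\dots,d).$$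
   Context: $[v]=\{1,\dots,v\}$; $\binom{[v]}{k}$ is the set of $k$-subsets of $[v]$. For a $v\times v$ matrix $A$ and $\alpha\subset[v]$, $A[\alpha]$ is the principal submatrix indexed by $\alpha$ and $\overline\alpha=[v]\setminus\alpha$. $D_A(k)=\{\det(A[\alpha]):\alpha\in\binom{[v]}{k}\}$. $c_A(\alpha,k)$ is the coefficient of $x^{v-k-|\alpha|}$ in $\det(xI-A[\overline\alpha])$. $\mathfrak H_A(v,k,a)$ is the $k$-uniform hypergraph on $[v]$ whose hyperedges are the $k$-subsets $\alpha$ with $\det(A[\alpha])=a$. A symmetric association scheme with $d\ge1$ classes on a finite set $\mathfrak X$ is $(\mathfrak X,\{R_i\}_{i=0}^d)$, with $R_i$ nonempty subsets of $\mathfrak X\times\mathfrak X$ whose $\{0,1\}$ adjacency matrices $A_i$ (with $(A_i)_{xy}=1$ iff $(x,y)\in R_i$) satisfy: $A_0=I$; $\sum_{i=0}^dA_i=J$ (all-ones); $A_i^{\top}=A_i$ for all $i$; and every product $A_iA_j$ lies in the linear span of $A_0,\dots,A_d$. Write $\tilde R_i=\{\{x,y\}:(x,y)\in R_i\}$. A $\operatorname{PBIBD}(v,k;\lambda_1,\dots,\lambda_d)$ (partially balanced incomplete block design) on this scheme, $|\mathfrak X|=v$, is a $k$-uniform hypergraph $(\mathfrak X,\mathfrak B)$ that is a $1$-design (every vertex lies in the same positive number of hyperedges) and such that for each $i\in\{1,\dots,d\}$ and each $(x,y)\in R_i$, the pair $\{x,y\}$ is contained in exactly $\lambda_i$ hyperedges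 ($\lambda_i\geq0$). -}

module Defs where

open import Algebra.Bundles.Raw using (RawRing)
import Algebra.Definitions.RawSemiring as RawSemiringDefinitions
open import Data.Bool.Base using (Bool; true; false; if_then_else_)
open import Data.Fin.Base using (Fin; zero; suc; toℕ; punchIn)
import Data.Fin.Properties as Fin
open import Data.Fin.Subset using (Subset; inside; outside; ∣_∣; ∁; ⁅_⁆; _∪_)
  renaming (_∈_ to _∈ₛ_)
open import Data.Integer.Base as ℤ using (ℤ; +_; -[1+_])
open import Data.List.Base using (List; []; _∷_; length; map)
open import Data.List.Membership.Propositional using () renaming (_∈_ to _∈ₗ_)
open import Data.List.Relation.Unary.Unique.Propositional using (Unique)
open import Data.Nat.Base as ℕ using (ℕ; zero; suc)
open import Data.Nat.Combinatorics using (_C_)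
import Data.Nat.Properties as ℕ
open import Data.Product.Base using (Σ; ∃-syntax; _×_; _,_; proj₁; proj₂)
open import Data.Rational.Base as ℚ using (ℚ; 0ℚ; 1ℚ)
import Data.Rational.Properties as ℚ
open import Data.Rational.Solver using (module +-*-Solver)
open import Data.Sum.Base using (_⊎_)
open import Data.Vec.Base using ([]; _∷_)
open import Function.Bundles using (_⇔_)
open import Level using (Level; 0ℓ)
open import Relation.Binary.PropositionalEquality using (_≡_; refl; sym; trans; cong; cong₂; subst)
open import Relation.Nullary using (yes; no; contradiction; does)
open import Relation.Unary using (Pred; _∈_)

private
  variable
    c ℓ : Level
    n : ℕ

-- The inverse of a rational, with the junk value 0 at 0.
recip : ℚ → ℚ
recip q with q ℚ.≟ 0ℚ
... | yes _  = 0ℚ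
... | no q≢0 = ℚ.1/_ q {{ℚ.≢-nonZero q≢0}}

module Estimates where
  open import Data.Rational.Base using (_+_; _*_; _-_; -_; _<_; _≤_) renaming (∣_∣ to abs)
  open ℚ.≤-Reasoning

  recip-inverse : ∀ {q} → 0ℚ < q → q * recip q ≡ 1ℚ
  recip-inverse {q} 0<q with q ℚ.≟ 0ℚ
  ... | yes q≡0 = contradiction (sym q≡0) (ℚ.<⇒≢ 0<q)
  ... | no q≢0  = ℚ.*-inverseʳ q {{ℚ.≢-nonZero q≢0}}

  0<recip : ∀ {q} → 0ℚ < q → 0ℚ < recip q
  0<recip {q} 0<q with q ℚ.≟ 0ℚ
  ... | yes q≡0 = contradiction (sym q≡0) (ℚ.<⇒≢ 0<q)
  ... | no _    = ℚ.positive⁻¹ _ {{ℚ.1/pos⇒pos q {{ℚ.positive 0<q}}}}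

  0<+ : ∀ {p q} → 0ℚ < p → 0ℚ < q → 0ℚ < p + q
  0<+ {p} {q} 0<p 0<q =
    ℚ.positive⁻¹ _ {{ℚ.pos+pos⇒pos p {{ℚ.positive 0<p}} q {{ℚ.positive 0<q}}}}

  ≤+ˡ : ∀ {p q} → 0ℚ < q → p ≤ p + q
  ≤+ˡ {p} {q} 0<q = subst (_≤ p + q) (ℚ.+-identityʳ p) (ℚ.+-monoʳ-≤ p (ℚ.<⇒≤ 0<q))

  ≤+ʳ : ∀ {p q} → 0ℚ < p → q ≤ p + q
  ≤+ʳ {p} {q} 0<p = subst (_≤ p + q) (ℚ.+-identityˡ q) (ℚ.+-monoˡ-≤ q (ℚ.<⇒≤ 0<p))

  0<* : ∀ {p q} → 0ℚ < p → 0ℚ < q → 0ℚ < p * q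
  0<* {p} {q} 0<p 0<q =
    ℚ.positive⁻¹ _ {{ℚ.pos*pos⇒pos p {{ℚ.positive 0<p}} q {{ℚ.positive 0<q}}}}

  *-mono-≤ˡ : ∀ {p q r} → 0ℚ ≤ r → p ≤ q → p * r ≤ q * r
  *-mono-≤ˡ {r = r} 0≤r = ℚ.*-monoʳ-≤-nonNeg r {{ℚ.nonNegative 0≤r}}

  *-mono-≤ʳ : ∀ {p q r} → 0ℚ ≤ r → p ≤ q → r * p ≤ r * q
  *-mono-≤ʳ {r = r} 0≤r = ℚ.*-monoˡ-≤-nonNeg r {{ℚ.nonNegative 0≤r}}

  *-mono-<ʳ : ∀ {p q r} → 0ℚ < r → p < q → r * p < r * q
  *-mono-<ʳ {r = r} 0<r = ℚ.*-monoʳ-<-pos r {{ℚ.positive 0<r}}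

  recip-anti : ∀ {p q} → 0ℚ < p → p ≤ q → recip q ≤ recip p
  recip-anti {p} {q} 0<p p≤q = begin
    recip q                 ≡⟨ ℚ.*-identityʳ _ ⟨
    recip q * 1ℚ            ≡⟨ cong (recip q *_) (recip-inverse 0<p) ⟨
    recip q * (p * recip p) ≤⟨ *-mono-≤ʳ (ℚ.<⇒≤ (0<recip 0<q))
                                 (*-mono-≤ˡ (ℚ.<⇒≤ (0<recip 0<p)) p≤q) ⟩
    recip q * (q * recip p) ≡⟨ solve 3 (λ a b c → a :* (b :* c) := (b :* a) :* c) refl
                                 (recip q) q (recip p) ⟩
    (q * recip q) * recip p ≡⟨ cong (_* recip p) (recip-inverse 0<q) ⟩
    1ℚ * recip p            ≡⟨ ℚ.*-identityˡ _ ⟩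
    recip p                 ∎
    where
    open +-*-Solver
    0<q = ℚ.<-≤-trans 0<p p≤q

  half : ℚ → ℚ
  half ε = ε * recip (1ℚ + 1ℚ)

  0<1 : 0ℚ < 1ℚ
  0<1 = ℚ.positive⁻¹ 1ℚ

  half+half : ∀ ε → half ε + half ε ≡ ε
  half+half ε = trans (sym (ℚ.*-distribˡ-+ ε (recip (1ℚ + 1ℚ)) (recip (1ℚ + 1ℚ)))) (ℚ.*-identityʳ ε)

  0<half : ∀ {ε} → 0ℚ < ε → 0ℚ < half ε
  0<half 0<ε = 0<* 0<ε (0<recip (ℚ.positive⁻¹ (1ℚ + 1ℚ)))

  +-close : ∀ {ε} x y x′ y′ → abs (x - x′) < half ε → abs (y - y′) < half ε →
            abs ((x + y) - (x′ + y′)) < ε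
  +-close {ε} x y x′ y′ x≈ y≈ = begin-strict
    abs ((x + y) - (x′ + y′))   ≡⟨ cong abs (solve 4 (λ x y x′ y′ →
                                     (x :+ y) :- (x′ :+ y′) := (x :- x′) :+ (y :- y′))
                                     refl x y x′ y′) ⟩
    abs ((x - x′) + (y - y′))   ≤⟨ ℚ.∣p+q∣≤∣p∣+∣q∣ (x - x′) (y - y′) ⟩
    abs (x - x′) + abs (y - y′) <⟨ ℚ.+-mono-< x≈ y≈ ⟩
    half ε + half ε             ≡⟨ half+half ε ⟩
    ε                           ∎
    where open +-*-Solver

  neg-close : ∀ {ε} x x′ → abs (x - x′) < ε → abs ((- x) - (- x′)) < ε
  neg-close {ε} x x′ = subst (_< ε) (trans (sym (ℚ.∣-p∣≡∣p∣ (x - x′)))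
    (cong abs (solve 2 (λ x x′ → :- (x :- x′) := (:- x) :- (:- x′)) refl x x′)))
    where open +-*-Solver

  *-close : ∀ {ε B} x y x′ y′ → 0ℚ < B → abs x ≤ B → abs y′ ≤ B →
            abs (x - x′) < half ε * recip B → abs (y - y′) < half ε * recip B →
            abs ((x * y) - (x′ * y′)) < ε
  *-close {ε} {B} x y x′ y′ 0<B x≤B y′≤B x≈ y≈ = begin-strict
    abs ((x * y) - (x′ * y′))
      ≡⟨ cong abs (solve 4 (λ x y x′ y′ →
           (x :* y) :- (x′ :* y′) := (x :* (y :- y′)) :+ (y′ :* (x :- x′))) refl x y x′ y′) ⟩
    abs (x * (y - y′) + y′ * (x - x′))
      ≤⟨ ℚ.∣p+q∣≤∣p∣+∣q∣ (x * (y - y′)) (y′ * (x - x′)) ⟩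
    abs (x * (y - y′)) + abs (y′ * (x - x′))
      ≡⟨ cong₂ _+_ (ℚ.∣p*q∣≡∣p∣*∣q∣ x (y - y′)) (ℚ.∣p*q∣≡∣p∣*∣q∣ y′ (x - x′)) ⟩
    abs x * abs (y - y′) + abs y′ * abs (x - x′)
      ≤⟨ ℚ.+-mono-≤ (*-mono-≤ˡ (ℚ.0≤∣p∣ (y - y′)) x≤B) (*-mono-≤ˡ (ℚ.0≤∣p∣ (x - x′)) y′≤B) ⟩
    B * abs (y - y′) + B * abs (x - x′)
      <⟨ ℚ.+-mono-< (*-mono-<ʳ 0<B y≈) (*-mono-<ʳ 0<B x≈) ⟩
    B * (half ε * recip B) + B * (half ε * recip B)
      ≡⟨ cong₂ _+_ cancel cancel ⟩
    half ε + half ε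
      ≡⟨ half+half ε ⟩
    ε ∎
    where
    open +-*-Solver
    cancel : B * (half ε * recip B) ≡ half ε
    cancel = trans (solve 3 (λ a b c → a :* (b :* c) := b :* (a :* c)) refl B (half ε) (recip B))
                   (trans (cong (half ε *_) (recip-inverse 0<B)) (ℚ.*-identityʳ (half ε)))

  recip-close : ∀ {ε e} p q → 0ℚ < e → e ≤ p → e ≤ q →
                abs (p - q) < ε * (e * e) → abs (recip p - recip q) < ε
  recip-close {ε} {e} p q 0<e e≤p e≤q p≈q = begin-strict
    abs (recip p - recip q)             ≡⟨ cong abs difference ⟩
    abs ((- (p - q)) * r)               ≡⟨ ℚ.∣p*q∣≡∣p∣*∣q∣ (- (p - q)) r ⟩
    abs (- (p - q)) * abs r             ≡⟨ cong₂ _*_ (ℚ.∣-p∣≡∣p∣ (p - q)) (ℚ.0≤p⇒∣p∣≡p 0≤r) ⟩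
    abs (p - q) * r                     ≤⟨ *-mono-≤ʳ (ℚ.0≤∣p∣ (p - q)) r≤s ⟩
    abs (p - q) * s                     ≡⟨ ℚ.*-comm (abs (p - q)) s ⟩
    s * abs (p - q)                     <⟨ *-mono-<ʳ 0<s p≈q ⟩
    s * (ε * (e * e))                   ≡⟨ cancel ⟩
    ε                                   ∎
    where
    0<p : 0ℚ < p
    0<p = ℚ.<-≤-trans 0<e e≤p
    0<q : 0ℚ < q
    0<q = ℚ.<-≤-trans 0<e e≤q
    r s : ℚ
    r = recip p * recip q
    s = recip e * recip e
    0≤r : 0ℚ ≤ r
    0≤r = ℚ.<⇒≤ (0<* (0<recip 0<p) (0<recip 0<q))
    0<s : 0ℚ < s
    0<s = 0<* (0<recip 0<e) (0<recip 0<e)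
    r≤s : r ≤ s
    r≤s = ℚ.≤-trans (*-mono-≤ˡ (ℚ.<⇒≤ (0<recip 0<q)) (recip-anti 0<e e≤p))
                    (*-mono-≤ʳ (ℚ.<⇒≤ (0<recip 0<e)) (recip-anti 0<e e≤q))

    factor : ∀ a b p q → p * a ≡ 1ℚ → q * b ≡ 1ℚ → a - b ≡ (- (p - q)) * (a * b)
    factor a b p q pa≡1 qb≡1 = sym (begin-equality
      (- (p - q)) * (a * b)         ≡⟨ solve 4 (λ a b p q → (:- (p :- q)) :* (a :* b)
                                         := a :* (q :* b) :- b :* (p :* a)) refl a b p q ⟩
      a * (q * b) - b * (p * a)     ≡⟨ cong₂ (λ x y → a * x - b * y) qb≡1 pa≡1 ⟩
      a * 1ℚ - b * 1ℚ               ≡⟨ cong₂ _-_ (ℚ.*-identityʳ a) (ℚ.*-identityʳ b) ⟩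
      a - b                         ∎)
      where open +-*-Solver

    difference : recip p - recip q ≡ (- (p - q)) * r
    difference = factor (recip p) (recip q) p q (recip-inverse 0<p) (recip-inverse 0<q)

    regroup : ∀ a → (a * a) * (ε * (e * e)) ≡ ε * ((e * a) * (e * a))
    regroup a = solve 3 (λ a ε e → (a :* a) :* (ε :* (e :* e)) := ε :* ((e :* a) :* (e :* a)))
                  refl a ε e
      where open +-*-Solver

    cancel : s * (ε * (e * e)) ≡ ε
    cancel = begin-equality
      s * (ε * (e * e))                   ≡⟨ regroup (recip e) ⟩
      ε * ((e * recip e) * (e * recip e)) ≡⟨ cong (λ z → ε * (z * z)) (recip-inverse 0<e) ⟩
      ε * (1ℚ * 1ℚ)                       ≡⟨ cong (ε *_) (ℚ.*-identityʳ 1ℚ) ⟩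
      ε * 1ℚ                              ≡⟨ ℚ.*-identityʳ ε ⟩
      ε                                   ∎

open Estimates

-- Real numbers as Cauchy sequences of rationals, with equality _≈ᴿ_ below
record ℝ : Set where
  constructor mkℝ
  field
    seq    : ℕ → ℚ
    cauchy : ∀ {ε} → 0ℚ ℚ.< ε →
             ∃[ N ] ∀ m n → N ℕ.≤ m → N ℕ.≤ n → ℚ.∣ seq m ℚ.- seq n ∣ ℚ.< ε

open ℝ

infix 4 _≈ᴿ_

_≈ᴿ_ : ℝ → ℝ → Set
x ≈ᴿ y = ∀ {ε} → 0ℚ ℚ.< ε → ∃[ N ] ∀ n → N ℕ.≤ n → ℚ.∣ seq x n ℚ.- seq y n ∣ ℚ.< ε

Positiveᴿ : ℝ → Set
Positiveᴿ x = ∃[ ε ] (0ℚ ℚ.< ε) × (∃[ N ] ∀ n → N ℕ.≤ n → ε ℚ.≤ seq x n)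

private
  ⊔ˡ : ∀ {a b m} → a ℕ.⊔ b ℕ.≤ m → a ℕ.≤ m
  ⊔ˡ {a} {b} = ℕ.≤-trans (ℕ.m≤m⊔n a b)

  ⊔ʳ : ∀ {a b m} → a ℕ.⊔ b ℕ.≤ m → b ℕ.≤ m
  ⊔ʳ {a} {b} = ℕ.≤-trans (ℕ.m≤n⊔m a b)

eventually-bounded : ∀ x → ∃[ B ] (0ℚ ℚ.< B) × (∃[ N ] ∀ n → N ℕ.≤ n → ℚ.∣ seq x n ∣ ℚ.≤ B)
eventually-bounded x with cauchy x 0<1
... | N , close = 1ℚ ℚ.+ ℚ.∣ seq x N ∣ , 0<B , N , bound
  where
  open import Data.Rational.Base using (_+_; _-_; _≤_) renaming (∣_∣ to abs)
  open ℚ.≤-Reasoning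
  open +-*-Solver
  0<B = ℚ.<-≤-trans 0<1 (subst (_≤ 1ℚ + abs (seq x N)) (ℚ.+-identityʳ 1ℚ)
                           (ℚ.+-monoʳ-≤ 1ℚ (ℚ.0≤∣p∣ (seq x N))))
  bound : ∀ n → N ℕ.≤ n → abs (seq x n) ≤ 1ℚ + abs (seq x N)
  bound n N≤n = begin
    abs (seq x n)                         ≡⟨ cong abs (solve 2 (λ a b → a := (a :- b) :+ b)
                                               refl (seq x n) (seq x N)) ⟩
    abs (seq x n - seq x N + seq x N)     ≤⟨ ℚ.∣p+q∣≤∣p∣+∣q∣ (seq x n - seq x N) (seq x N) ⟩
    abs (seq x n - seq x N) + abs (seq x N)
      ≤⟨ ℚ.+-monoˡ-≤ (abs (seq x N)) (ℚ.<⇒≤ (close n N N≤n ℕ.≤-refl)) ⟩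
    1ℚ + abs (seq x N)                    ∎

fromℚ : ℚ → ℝ
fromℚ q .seq _ = q
fromℚ q .cauchy {ε} 0<ε =
  0 , λ _ _ _ _ → subst (λ z → ℚ.∣ z ∣ ℚ.< ε) (sym (ℚ.+-inverseʳ q)) 0<ε

infixl 6 _+ᴿ_
infixl 7 _*ᴿ_
infix  8 -ᴿ_

_+ᴿ_ : ℝ → ℝ → ℝ
(x +ᴿ y) .seq n = seq x n ℚ.+ seq y n
(x +ᴿ y) .cauchy 0<ε with cauchy x (0<half 0<ε) | cauchy y (0<half 0<ε)
... | M , x≈ | N , y≈ = M ℕ.⊔ N , λ m n M≤m M≤n →
  +-close (seq x m) (seq y m) (seq x n) (seq y n)
    (x≈ m n (⊔ˡ M≤m) (⊔ˡ M≤n)) (y≈ m n (⊔ʳ {M} M≤m) (⊔ʳ {M} M≤n))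

-ᴿ_ : ℝ → ℝ
(-ᴿ x) .seq n = ℚ.- seq x n
(-ᴿ x) .cauchy 0<ε with cauchy x 0<ε
... | N , x≈ = N , λ m n N≤m N≤n → neg-close (seq x m) (seq x n) (x≈ m n N≤m N≤n)

_*ᴿ_ : ℝ → ℝ → ℝ
(x *ᴿ y) .seq n = seq x n ℚ.* seq y n
(x *ᴿ y) .cauchy {ε} 0<ε = K ℕ.⊔ L ℕ.⊔ (M ℕ.⊔ N) , λ m n ≤m ≤n →
  *-close {ε} {B} (seq x m) (seq y m) (seq x n) (seq y n) 0<B
    (ℚ.≤-trans (x≤ m (⊔ˡ {K} {L} (⊔ˡ {K ℕ.⊔ L} {M ℕ.⊔ N} ≤m))) (≤+ˡ 0<By))
    (ℚ.≤-trans (y≤ n (⊔ʳ {K} {L} (⊔ˡ {K ℕ.⊔ L} {M ℕ.⊔ N} ≤n))) (≤+ʳ 0<Bx))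
    (x≈ m n (⊔ˡ {M} {N} (⊔ʳ {K ℕ.⊔ L} {M ℕ.⊔ N} ≤m)) (⊔ˡ {M} {N} (⊔ʳ {K ℕ.⊔ L} {M ℕ.⊔ N} ≤n)))
    (y≈ m n (⊔ʳ {M} {N} (⊔ʳ {K ℕ.⊔ L} {M ℕ.⊔ N} ≤m)) (⊔ʳ {M} {N} (⊔ʳ {K ℕ.⊔ L} {M ℕ.⊔ N} ≤n)))
  where
  bx = eventually-bounded x
  by = eventually-bounded y
  Bx = proj₁ bx
  By = proj₁ by
  0<Bx = proj₁ (proj₂ bx)
  0<By = proj₁ (proj₂ by)
  K = proj₁ (proj₂ (proj₂ bx))
  L = proj₁ (proj₂ (proj₂ by))
  x≤ = proj₂ (proj₂ (proj₂ bx))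
  y≤ = proj₂ (proj₂ (proj₂ by))
  B : ℚ
  B = Bx ℚ.+ By
  0<B : 0ℚ ℚ.< B
  0<B = 0<+ 0<Bx 0<By
  0<δ : 0ℚ ℚ.< half ε ℚ.* recip B
  0<δ = 0<* (0<half 0<ε) (0<recip 0<B)
  M = proj₁ (cauchy x 0<δ)
  N = proj₁ (cauchy y 0<δ)
  x≈ = proj₂ (cauchy x 0<δ)
  y≈ = proj₂ (cauchy y 0<δ)

recipᴿ : (x : ℝ) → Positiveᴿ x → ℝ
recipᴿ x _ .seq n = recip (seq x n)
recipᴿ x (e , 0<e , K , e≤x) .cauchy 0<ε with cauchy x (0<* 0<ε (0<* 0<e 0<e))
... | N , x≈ = K ℕ.⊔ N , λ m n ≤m ≤n →
  recip-close (seq x m) (seq x n) 0<e (e≤x m (⊔ˡ ≤m)) (e≤x n (⊔ˡ ≤n))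
    (x≈ m n (⊔ʳ {K} ≤m) (⊔ʳ {K} ≤n))

record ℂ : Set where
  constructor _+i_
  field
    re im : ℝ

open ℂ

infix  4 _≈ᶜ_ _#_
infixl 6 _+ᶜ_ _-ᶜ_
infixl 7 _*ᶜ_ _÷_⟨_⟩
infix  8 -ᶜ_

_≈ᶜ_ : ℂ → ℂ → Set
z ≈ᶜ w = (re z ≈ᴿ re w) × (im z ≈ᴿ im w)

0ᶜ 1ᶜ : ℂ
0ᶜ = fromℚ 0ℚ +i fromℚ 0ℚ
1ᶜ = fromℚ 1ℚ +i fromℚ 0ℚ

-ᶜ_ : ℂ → ℂ
-ᶜ z = (-ᴿ re z) +i (-ᴿ im z)

_+ᶜ_ _*ᶜ_ : ℂ → ℂ → ℂ
z +ᶜ w = (re z +ᴿ re w) +i (im z +ᴿ im w)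
z *ᶜ w = (re z *ᴿ re w +ᴿ (-ᴿ (im z *ᴿ im w))) +i (re z *ᴿ im w +ᴿ im z *ᴿ re w)

_-ᶜ_ : ℂ → ℂ → ℂ
z -ᶜ w = z +ᶜ (-ᶜ w)

∣_∣² : ℂ → ℝ
∣ z ∣² = re z *ᴿ re z +ᴿ im z *ᴿ im z

-- Inequality of complex numbers in its positive form ∣ z - w ∣ > 0, which is
-- what division by z - w requires; classically it is ¬ (z ≈ᶜ w).
_#_ : ℂ → ℂ → Set
z # w = Positiveᴿ ∣ z -ᶜ w ∣²

ℂ-rawRing : RawRing 0ℓ 0ℓ
ℂ-rawRing = record
  { Carrier = ℂ ; _≈_ = _≈ᶜ_ ; _+_ = _+ᶜ_ ; _*_ = _*ᶜ_ ; -_ = -ᶜ_ ; 0# = 0ᶜ ; 1# = 1ᶜ }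

_÷_⟨_⟩ : ℂ → (w : ℂ) → Positiveᴿ ∣ w ∣² → ℂ
z ÷ w ⟨ w#0 ⟩ = z *ᶜ ((re w *ᴿ r) +i (-ᴿ (im w *ᴿ r)))
  where r = recipᴿ ∣ w ∣² w#0

open RawSemiringDefinitions (RawRing.rawSemiring ℂ-rawRing) public
  using () renaming (_^_ to _^ᶜ_; _×_ to _×ᶜ_; sum to sumᶜ)

fromℕ : ℕ → ℂ
fromℕ m = m ×ᶜ 1ᶜ

Matrix : Set c → ℕ → Set c
Matrix X n = Fin n → Fin n → X

module MatrixOps (R : RawRing c ℓ) where
  open RawRing R
  open RawSemiringDefinitions rawSemiring using (sum; _^_)

  infix  4 _≋_
  infixl 7 _⊗_

  _≋_ : Matrix Carrier n → Matrix Carrier n → Set ℓ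
  M ≋ N = ∀ i j → M i j ≈ N i j

  diagonal : (Fin n → Carrier) → Matrix Carrier n
  diagonal e i j = if does (i Fin.≟ j) then e i else 0#

  𝟙 : Matrix Carrier n
  𝟙 = diagonal (λ _ → 1#)

  _⊗_ : Matrix Carrier n → Matrix Carrier n → Matrix Carrier n
  (M ⊗ N) i j = sum (λ l → M i l * N l j)

  -- Laplace expansion along the first row
  det : Matrix Carrier n → Carrier
  det {zero}  M = 1#
  det {suc n} M =
    sum (λ j → (- 1#) ^ toℕ j * (M zero j * det (λ i l → M (suc i) (punchIn j l))))

  Diagonalisable : Matrix Carrier n → Set _
  Diagonalisable {n} M =
    ∃[ P ] ∃[ P⁻¹ ] (P ⊗ P⁻¹ ≋ 𝟙) × (P⁻¹ ⊗ P ≋ 𝟙) ×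
      Σ (Fin n → Carrier) (λ e → P⁻¹ ⊗ M ⊗ P ≋ diagonal e)

-- The increasing enumeration of a subset
element : (α : Subset n) → Fin ∣ α ∣ → Fin n
element (inside  ∷ α) zero    = zero
element (inside  ∷ α) (suc i) = suc (element α i)
element (outside ∷ α) i       = suc (element α i)

infix 9 _[_]

_[_] : {X : Set c} → Matrix X n → (α : Subset n) → Matrix X ∣ α ∣
(A [ α ]) i j = A (element α i) (element α j)

-- Polynomials as lists of coefficients, lowest degree first
module Polynomial (R : RawRing c ℓ) where
  open RawRing R

  Poly : Set c
  Poly = List Carrier

  coefficient : Poly → ℕ → Carrier
  coefficient []      m       = 0#
  coefficient (a ∷ p) zero    = a
  coefficient (a ∷ p) (suc m) = coefficient p m

  -- Negative powers of x do not occur.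
  coefficientℤ : Poly → ℤ → Carrier
  coefficientℤ p (+ m)    = coefficient p m
  coefficientℤ p -[1+ m ] = 0#

  constant : Carrier → Poly
  constant a = a ∷ []

  x : Poly
  x = 0# ∷ 1# ∷ []

  _+ₚ_ _*ₚ_ : Poly → Poly → Poly
  []      +ₚ q       = q
  (a ∷ p) +ₚ []      = a ∷ p
  (a ∷ p) +ₚ (b ∷ q) = (a + b) ∷ (p +ₚ q)

  []      *ₚ q = []
  (a ∷ p) *ₚ q = map (a *_) q +ₚ (0# ∷ (p *ₚ q))

  -ₚ_ : Poly → Poly
  -ₚ_ = map (-_)

  -- Trailing zero coefficients are irrelevant.
  poly-rawRing : RawRing c ℓ
  poly-rawRing = record
    { Carrier = Poly
    ; _≈_     = λ p q → ∀ m → coefficient p m ≈ coefficient q m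
    ; _+_     = _+ₚ_
    ; _*_     = _*ₚ_
    ; -_      = -ₚ_
    ; 0#      = []
    ; 1#      = constant 1#
    }

  charPoly : Matrix Carrier n → Poly
  charPoly M = det (λ i j → (x *ₚ 𝟙 i j) +ₚ (-ₚ constant (M i j)))
    where open MatrixOps poly-rawRing

open MatrixOps ℂ-rawRing public
open Polynomial ℂ-rawRing public using (coefficientℤ; charPoly)

principalMinors : Matrix ℂ n → ℕ → Pred ℂ 0ℓ
principalMinors A k z = ∃[ α ] ∣ α ∣ ≡ k × det (A [ α ]) ≈ᶜ z

-- The exponent n - k - ∣ α ∣ can be negative, e.g. for k = n - 1 and ∣ α ∣ = 2.
coeff : Matrix ℂ n → Subset n → ℕ → ℂ
coeff {n} A α k = coefficientℤ (charPoly (A [ ∁ α ])) (+ n ℤ.- + k ℤ.- + ∣ α ∣)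

pairSet : ℂ → ℂ → Pred ℂ 0ℓ
pairSet a b z = (z ≈ᶜ a) ⊎ (z ≈ᶜ b)

-- A binary relation on [n], as the indicator function of a subset of [n] × [n]
Relation : ℕ → Set
Relation n = Fin n → Fin n → Bool

adjacency : Relation n → Matrix ℂ n
adjacency R i j = if R i j then 1ᶜ else 0ᶜ

record AssociationScheme (v d : ℕ) : Set where
  field
    d≥1       : 1 ℕ.≤ d
    R         : Fin (suc d) → Relation v
    nonempty  : ∀ i → ∃[ x ] ∃[ y ] R i x y ≡ true
    identity  : adjacency (R zero) ≋ 𝟙
    all-ones  : (λ x y → sumᶜ (λ i → adjacency (R i) x y)) ≋ (λ _ _ → 1ᶜ)
    symmetric : ∀ i → (λ x y → adjacency (R i) y x) ≋ adjacency (R i)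
    product   : ∀ i j → Σ (Fin (suc d) → ℂ) λ p →
                adjacency (R i) ⊗ adjacency (R j) ≋
                (λ x y → sumᶜ (λ l → p l *ᶜ adjacency (R l) x y))

  unorderedPairs : Fin (suc d) → Pred (Subset v) 0ℓ
  unorderedPairs i α = ∃[ x ] ∃[ y ] R i x y ≡ true × α ≡ ⁅ x ⁆ ∪ ⁅ y ⁆

-- A hypergraph on [n], as its set of hyperedges
Hypergraph : ℕ → Set₁
Hypergraph n = Pred (Subset n) 0ℓ

HasCardinality : {X : Set} → Pred X 0ℓ → ℕ → Set
HasCardinality P m = ∃[ xs ] Unique xs × length xs ≡ m × (∀ x → (x ∈ₗ xs) ⇔ P x)

Uniform : ℕ → Hypergraph n → Set
Uniform k H = ∀ α → α ∈ H → ∣ α ∣ ≡ k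

OneDesign : Hypergraph n → Set
OneDesign H = ∃[ r ] 1 ℕ.≤ r × (∀ x → HasCardinality (λ α → α ∈ H × x ∈ₛ α) r)

-- The parameter λᵢ, for i ∈ {1, …, d}, is lam (i - 1).
record IsPBIBD {v d} (𝓧 : AssociationScheme v d) (k : ℕ) (lam : Fin d → ℕ)
               (H : Hypergraph v) : Set where
  open AssociationScheme 𝓧
  field
    uniform  : Uniform k H
    1-design : OneDesign H
    balanced : ∀ i x y → R (suc i) x y ≡ true →
               HasCardinality (λ α → α ∈ H × (x ∈ₛ α × y ∈ₛ α)) (lam i)

ℌ : Matrix ℂ n → ℕ → ℂ → Hypergraph n
ℌ A k a α = ∣ α ∣ ≡ k × det (A [ α ]) ≈ᶜ a

-- Binomial coefficient at integers n ≥ 0 and m, with value 0 when m < 0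
-- (and, as a junk value, when n < 0).
binomial : ℤ → ℤ → ℕ
binomial (+ n)    (+ m)    = n C m
binomial (+ n)    -[1+ m ] = 0
binomial -[1+ n ] m        = 0

{-# OPTIONS --safe #-}
module Submission where

-- Up to the sign (-1)ᵏ, the coefficient c_A(α,k) is the sum of the k × k principal
-- minors of A that avoid α. Inclusion-exclusion over {x, y} therefore turns
-- c₀ - 2c₁ + c₂ into the sum of the minors on the k-sets containing x and y, and as
-- every minor is a or b, this sum together with the number of such k-sets (the same
-- computation with all minors replaced by 1) determines how many of them have value a.
-- Taking y = x gives the regularity of the hypergraph.
--
-- For the coefficients, expand the determinant of x I - A row by row: the coefficient
-- of xᵐ is the sum over the m-sets S of the determinants of the matrices whose rows
-- in S come from I and whose other rows come from -A, and each of these is the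
-- principal minor of -A on the complement of S.

open import Defs hiding (_≋_; 𝟙; det; coefficientℤ; charPoly)
open import Algebra.Bundles using (CommutativeRing)
open import Algebra.Bundles.Raw using (RawRing)
open import Algebra.Structures using (IsCommutativeRing)
import Algebra.Definitions.RawSemiring as RawSemiringDefinitions
import Algebra.Properties.Group as GroupProperties
import Algebra.Properties.Ring as RingProperties
import Algebra.Properties.Semiring.Exp as SemiringExp
import Algebra.Properties.Semiring.Mult as SemiringMult
import Algebra.Properties.Semiring.Sum as SemiringSum
import Algebra.Solver.Ring.NaturalCoefficients.Default as SemiringSolver
open import Data.Bool.Base using (Bool; true; false; not; _∧_; if_then_else_)
open import Data.Fin.Base using (Fin; zero; suc; toℕ; cast; punchIn; pinch)
import Data.Fin.Properties as Fin
open import Data.Fin.Subset using (Subset; inside; outside; ∣_∣; ∁; ⊥; ⁅_⁆; _∪_)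
  renaming (_∈_ to _∈ₛ_; _⊆_ to _⊆ₛ_)
open import Data.Fin.Subset.Properties as Subset using (nonempty?; Empty-unique; _∈?_; _⊆?_)
open import Data.Integer.Base as ℤ using (+_; _-_)
import Data.Integer.Properties as ℤ
open import Data.List.Base as List using (List; []; _∷_; _++_; foldr; length; filter)
import Data.List.Membership.Propositional as List
open import Data.List.Membership.Propositional.Properties
  using (∈-map⁺; ∈-map⁻; ∈-++⁺ˡ; ∈-++⁺ʳ; ∈-++⁻; ∈-filter⁺; ∈-filter⁻)
open import Data.List.Relation.Unary.All using ([])
open import Data.List.Relation.Unary.AllPairs using ([]; _∷_)
open import Data.List.Relation.Unary.Any using (here; there)
open import Data.List.Relation.Unary.Unique.Propositional using (Unique)
import Data.List.Relation.Unary.Unique.Propositional.Properties as Unique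
open import Data.Nat.Base as ℕ using (ℕ; zero; suc; _≤_; z≤n; s≤s)
open import Data.Nat.Combinatorics using (_C_; nCk+nC[k+1]≡[n+1]C[k+1])
import Data.Nat.Properties as ℕ
import Data.Nat.Solver as ℕ
open import Data.Product.Base using (Σ; ∃-syntax; _×_; _,_; proj₁; proj₂)
open import Data.Rational.Base as ℚ using (ℚ; 0ℚ; 1ℚ)
import Data.Rational.Properties as ℚ
open import Data.Rational.Solver using (module +-*-Solver)
open import Data.Sum.Base using (_⊎_; inj₁; inj₂; [_,_]′)
open import Data.Vec.Base using ([]; _∷_; lookup; removeAt; here; there)
import Data.Vec.Properties as Vec
open import Function.Bundles using (mk⇔)
open import Level using (0ℓ)
open import Relation.Binary.Definitions using (tri<; tri≈; tri>)
open import Relation.Binary.PropositionalEquality as ≡ using (_≡_; _≢_; cong; cong₂; subst)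
open import Relation.Nullary using (¬_; contradiction; yes; no; does)
open import Relation.Nullary.Decidable using (dec-true; dec-false; does-⇔; ¬?; _×-dec_)
open import Relation.Unary using (Pred; Decidable; _∈_; _≐_)

open ℝ
open ℂ
open Estimates

-- Equality of Cauchy reals is not decidable, so comparing a minor with `a` does not by itself
-- single out the blocks. The hypotheses decide it: every principal minor of order `k` comes with a
-- proof that it is `a` or a proof that it is `b`, and `a # b` supplies an inverse `u` of a - b,
-- which keeps the two values apart. This is what allows the blocks to be listed by filtering the
-- k-subsets.
--
-- The counting identities determine the number of blocks only as an element of ℂ, whereas a design
-- asks for equal natural numbers; the way back is the injectivity of `fromℕ`. This injectivity, the
-- inverse `u` and the ring laws are all that the counting uses of ℂ, so it is carried out over an
-- abstract commutative ring. Many identities there are stated additively, with no subtraction,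
-- because they are left to a solver for commutative semirings.

private
  variable
    m n v : ℕ

-- The commutative ring ℂ

∣p-q∣≡∣q-p∣ : ∀ p q → ℚ.∣ p ℚ.- q ∣ ≡ ℚ.∣ q ℚ.- p ∣
∣p-q∣≡∣q-p∣ p q = ≡.trans (≡.sym (ℚ.∣-p∣≡∣p∣ (p ℚ.- q)))
  (cong ℚ.∣_∣ (solve 2 (λ p q → :- (p :- q) := q :- p) ≡.refl p q))
  where open +-*-Solver

-- Needed for reciprocals: before the index from which a sequence is bounded away from 0, a term may
-- be 0, and there `recip` returns 0 instead of an inverse.
eventually-≡⇒≈ᴿ : ∀ x y N → (∀ n → N ℕ.≤ n → seq x n ≡ seq y n) → x ≈ᴿ y
eventually-≡⇒≈ᴿ x y N x≡y {ε} 0<ε = N , λ n N≤n →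
  subst (λ z → ℚ.∣ seq x n ℚ.- z ∣ ℚ.< ε) (x≡y n N≤n)
    (subst (λ z → ℚ.∣ z ∣ ℚ.< ε) (≡.sym (ℚ.+-inverseʳ (seq x n))) 0<ε)

≗⇒≈ᴿ : ∀ x y → (∀ n → seq x n ≡ seq y n) → x ≈ᴿ y
≗⇒≈ᴿ x y x≡y = eventually-≡⇒≈ᴿ x y 0 (λ n _ → x≡y n)

≈ᴿ-sym : ∀ x y → x ≈ᴿ y → y ≈ᴿ x
≈ᴿ-sym x y x≈y {ε} 0<ε with x≈y 0<ε
... | N , close = N , λ n N≤n →
  subst (ℚ._< ε) (∣p-q∣≡∣q-p∣ (seq x n) (seq y n)) (close n N≤n)

≈ᴿ-trans : ∀ x y z → x ≈ᴿ y → y ≈ᴿ z → x ≈ᴿ z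
≈ᴿ-trans x y z x≈y y≈z {ε} 0<ε with x≈y (0<half 0<ε) | y≈z (0<half 0<ε)
... | M , closeM | N , closeN = M ℕ.⊔ N , λ n ≤n →
  subst (λ w → ℚ.∣ w ∣ ℚ.< ε)
    (solve 3 (λ x y z → (x :+ y) :- (y :+ z) := x :- z) ≡.refl (seq x n) (seq y n) (seq z n))
    (+-close {ε} (seq x n) (seq y n) (seq y n) (seq z n)
      (closeM n (ℕ.≤-trans (ℕ.m≤m⊔n M N) ≤n)) (closeN n (ℕ.≤-trans (ℕ.m≤n⊔m M N) ≤n)))
  where open +-*-Solver

+ᴿ-cong : ∀ x x′ y y′ → x ≈ᴿ x′ → y ≈ᴿ y′ → x +ᴿ y ≈ᴿ x′ +ᴿ y′
+ᴿ-cong x x′ y y′ x≈ y≈ {ε} 0<ε with x≈ (0<half 0<ε) | y≈ (0<half 0<ε)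
... | M , closeM | N , closeN = M ℕ.⊔ N , λ n ≤n →
  +-close {ε} (seq x n) (seq y n) (seq x′ n) (seq y′ n)
    (closeM n (ℕ.≤-trans (ℕ.m≤m⊔n M N) ≤n)) (closeN n (ℕ.≤-trans (ℕ.m≤n⊔m M N) ≤n))

-ᴿ-cong : ∀ x x′ → x ≈ᴿ x′ → -ᴿ x ≈ᴿ -ᴿ x′
-ᴿ-cong x x′ x≈ {ε} 0<ε with x≈ 0<ε
... | N , close = N , λ n N≤n → neg-close (seq x n) (seq x′ n) (close n N≤n)

*ᴿ-cong : ∀ x x′ y y′ → x ≈ᴿ x′ → y ≈ᴿ y′ → x *ᴿ y ≈ᴿ x′ *ᴿ y′
*ᴿ-cong x x′ y y′ x≈ y≈ {ε} 0<ε = K ℕ.⊔ L ℕ.⊔ (M ℕ.⊔ N) , λ n ≤n →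
  let ≤KL = ℕ.≤-trans (ℕ.m≤m⊔n (K ℕ.⊔ L) (M ℕ.⊔ N)) ≤n
      ≤MN = ℕ.≤-trans (ℕ.m≤n⊔m (K ℕ.⊔ L) (M ℕ.⊔ N)) ≤n
  in *-close {ε} {B} (seq x n) (seq y n) (seq x′ n) (seq y′ n) 0<B
       (ℚ.≤-trans (proj₂ (proj₂ (proj₂ bx)) n (ℕ.≤-trans (ℕ.m≤m⊔n K L) ≤KL)) (≤+ˡ 0<By))
       (ℚ.≤-trans (proj₂ (proj₂ (proj₂ by)) n (ℕ.≤-trans (ℕ.m≤n⊔m K L) ≤KL)) (≤+ʳ 0<Bx))
       (proj₂ (x≈ 0<δ) n (ℕ.≤-trans (ℕ.m≤m⊔n M N) ≤MN))
       (proj₂ (y≈ 0<δ) n (ℕ.≤-trans (ℕ.m≤n⊔m M N) ≤MN))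
  where
  -- Bounds on `x` and `y′` suffice, because xy - x′y′ = x(y - y′) + y′(x - x′).
  bx = eventually-bounded x
  by = eventually-bounded y′
  0<Bx = proj₁ (proj₂ bx)
  0<By = proj₁ (proj₂ by)
  K = proj₁ (proj₂ (proj₂ bx))
  L = proj₁ (proj₂ (proj₂ by))
  B : ℚ
  B = proj₁ bx ℚ.+ proj₁ by
  0<B : 0ℚ ℚ.< B
  0<B = 0<+ 0<Bx 0<By
  0<δ : 0ℚ ℚ.< half ε ℚ.* recip B
  0<δ = 0<* (0<half 0<ε) (0<recip 0<B)
  M = proj₁ (x≈ 0<δ)
  N = proj₁ (y≈ 0<δ)

≗⇒≈ᶜ : ∀ z w → (∀ n → seq (re z) n ≡ seq (re w) n) → (∀ n → seq (im z) n ≡ seq (im w) n) → z ≈ᶜ w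
≗⇒≈ᶜ z w re≡ im≡ = ≗⇒≈ᴿ (re z) (re w) re≡ , ≗⇒≈ᴿ (im z) (im w) im≡

ιʳ ιⁱ : ℂ → ℕ → ℚ
ιʳ z = seq (re z)
ιⁱ z = seq (im z)

*ᶜ-cong : ∀ {z z′ w w′} → z ≈ᶜ z′ → w ≈ᶜ w′ → z *ᶜ w ≈ᶜ z′ *ᶜ w′
*ᶜ-cong {x +i y} {x′ +i y′} {s +i t} {s′ +i t′} (x≈ , y≈) (s≈ , t≈) =
  +ᴿ-cong (x *ᴿ s) (x′ *ᴿ s′) (-ᴿ (y *ᴿ t)) (-ᴿ (y′ *ᴿ t′))
    (*ᴿ-cong x x′ s s′ x≈ s≈)
    (-ᴿ-cong (y *ᴿ t) (y′ *ᴿ t′) (*ᴿ-cong y y′ t t′ y≈ t≈)) ,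
  +ᴿ-cong (x *ᴿ t) (x′ *ᴿ t′) (y *ᴿ s) (y′ *ᴿ s′)
    (*ᴿ-cong x x′ t t′ x≈ t≈) (*ᴿ-cong y y′ s s′ y≈ s≈)

-- The operations act on sequences index by index, so each algebraic law is an identity of rationals
-- at every index. Only the equivalence and congruence fields involve ε.
ℂ-commutativeRing : CommutativeRing 0ℓ 0ℓ
ℂ-commutativeRing = record
  { RawRing ℂ-rawRing
  ; isCommutativeRing = record
    { isRing = record
      { +-isAbelianGroup = record
        { isGroup = record
          { isMonoid = record
            { isSemigroup = record
              { isMagma = record
                { isEquivalence = record
                  { refl  = λ {z} → ≗⇒≈ᶜ z z (λ _ → ≡.refl) (λ _ → ≡.refl)
                  ; sym   = λ {z} {w} (r , i) →
                      ≈ᴿ-sym (re z) (re w) r , ≈ᴿ-sym (im z) (im w) i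
                  ; trans = λ {z} {w} {u} (r , i) (r′ , i′) →
                      ≈ᴿ-trans (re z) (re w) (re u) r r′ , ≈ᴿ-trans (im z) (im w) (im u) i i′
                  }
                ; ∙-cong = λ {z} {z′} {w} {w′} (r , i) (r′ , i′) →
                    +ᴿ-cong (re z) (re z′) (re w) (re w′) r r′ ,
                    +ᴿ-cong (im z) (im z′) (im w) (im w′) i i′
                }
              ; assoc = λ z w u → ≗⇒≈ᶜ (z +ᶜ w +ᶜ u) (z +ᶜ (w +ᶜ u))
                  (λ n → ℚ.+-assoc (ιʳ z n) (ιʳ w n) (ιʳ u n))
                  (λ n → ℚ.+-assoc (ιⁱ z n) (ιⁱ w n) (ιⁱ u n))
              }
            ; identity =
                (λ z → ≗⇒≈ᶜ (0ᶜ +ᶜ z) z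
                  (λ n → ℚ.+-identityˡ (ιʳ z n)) (λ n → ℚ.+-identityˡ (ιⁱ z n))) ,
                (λ z → ≗⇒≈ᶜ (z +ᶜ 0ᶜ) z
                  (λ n → ℚ.+-identityʳ (ιʳ z n)) (λ n → ℚ.+-identityʳ (ιⁱ z n)))
            }
          ; inverse =
              (λ z → ≗⇒≈ᶜ (-ᶜ z +ᶜ z) 0ᶜ
                (λ n → ℚ.+-inverseˡ (ιʳ z n)) (λ n → ℚ.+-inverseˡ (ιⁱ z n))) ,
              (λ z → ≗⇒≈ᶜ (z +ᶜ -ᶜ z) 0ᶜ
                (λ n → ℚ.+-inverseʳ (ιʳ z n)) (λ n → ℚ.+-inverseʳ (ιⁱ z n)))
          ; ⁻¹-cong = λ {z} {w} (r , i) → -ᴿ-cong (re z) (re w) r , -ᴿ-cong (im z) (im w) i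
          }
        ; comm = λ z w → ≗⇒≈ᶜ (z +ᶜ w) (w +ᶜ z)
            (λ n → ℚ.+-comm (ιʳ z n) (ιʳ w n)) (λ n → ℚ.+-comm (ιⁱ z n) (ιⁱ w n))
        }
      ; *-cong = λ {z} {z′} {w} {w′} → *ᶜ-cong {z} {z′} {w} {w′}
      ; *-assoc = λ z w u → ≗⇒≈ᶜ (z *ᶜ w *ᶜ u) (z *ᶜ (w *ᶜ u))
          (λ n → solve 6 (λ x y s t p q →
            (x :* s :+ :- (y :* t)) :* p :+ :- ((x :* t :+ y :* s) :* q) :=
            x :* (s :* p :+ :- (t :* q)) :+ :- (y :* (s :* q :+ t :* p))) ≡.refl
            (ιʳ z n) (ιⁱ z n) (ιʳ w n) (ιⁱ w n) (ιʳ u n) (ιⁱ u n))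
          (λ n → solve 6 (λ x y s t p q →
            (x :* s :+ :- (y :* t)) :* q :+ (x :* t :+ y :* s) :* p :=
            x :* (s :* q :+ t :* p) :+ y :* (s :* p :+ :- (t :* q))) ≡.refl
            (ιʳ z n) (ιⁱ z n) (ιʳ w n) (ιⁱ w n) (ιʳ u n) (ιⁱ u n))
      ; *-identity =
          (λ z → ≗⇒≈ᶜ (1ᶜ *ᶜ z) z
            (λ n → solve 2 (λ x y → con 1ℚ :* x :+ :- (con 0ℚ :* y) := x) ≡.refl (ιʳ z n) (ιⁱ z n))
            (λ n → solve 2 (λ x y → con 1ℚ :* y :+ con 0ℚ :* x := y) ≡.refl (ιʳ z n) (ιⁱ z n))) ,
          (λ z → ≗⇒≈ᶜ (z *ᶜ 1ᶜ) z
            (λ n → solve 2 (λ x y → x :* con 1ℚ :+ :- (y :* con 0ℚ) := x) ≡.refl (ιʳ z n) (ιⁱ z n))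
            (λ n → solve 2 (λ x y → x :* con 0ℚ :+ y :* con 1ℚ := y) ≡.refl (ιʳ z n) (ιⁱ z n)))
      ; distrib =
          (λ z w u → ≗⇒≈ᶜ (z *ᶜ (w +ᶜ u)) (z *ᶜ w +ᶜ z *ᶜ u)
            (λ n → solve 6 (λ x y s t p q →
              x :* (s :+ p) :+ :- (y :* (t :+ q)) :=
              (x :* s :+ :- (y :* t)) :+ (x :* p :+ :- (y :* q))) ≡.refl
              (ιʳ z n) (ιⁱ z n) (ιʳ w n) (ιⁱ w n) (ιʳ u n) (ιⁱ u n))
            (λ n → solve 6 (λ x y s t p q →
              x :* (t :+ q) :+ y :* (s :+ p) :=
              (x :* t :+ y :* s) :+ (x :* q :+ y :* p)) ≡.refl
              (ιʳ z n) (ιⁱ z n) (ιʳ w n) (ιⁱ w n) (ιʳ u n) (ιⁱ u n))) ,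
          (λ z w u → ≗⇒≈ᶜ ((w +ᶜ u) *ᶜ z) (w *ᶜ z +ᶜ u *ᶜ z)
            (λ n → solve 6 (λ x y s t p q →
              (s :+ p) :* x :+ :- ((t :+ q) :* y) :=
              (s :* x :+ :- (t :* y)) :+ (p :* x :+ :- (q :* y))) ≡.refl
              (ιʳ z n) (ιⁱ z n) (ιʳ w n) (ιⁱ w n) (ιʳ u n) (ιⁱ u n))
            (λ n → solve 6 (λ x y s t p q →
              (s :+ p) :* y :+ (t :+ q) :* x :=
              (s :* y :+ t :* x) :+ (p :* y :+ q :* x)) ≡.refl
              (ιʳ z n) (ιⁱ z n) (ιʳ w n) (ιⁱ w n) (ιʳ u n) (ιⁱ u n)))
      }
    ; *-comm = λ z w → ≗⇒≈ᶜ (z *ᶜ w) (w *ᶜ z)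
        (λ n → solve 4 (λ x y s t → x :* s :+ :- (y :* t) := s :* x :+ :- (t :* y)) ≡.refl
          (ιʳ z n) (ιⁱ z n) (ιʳ w n) (ιⁱ w n))
        (λ n → solve 4 (λ x y s t → x :* t :+ y :* s := s :* y :+ t :* x) ≡.refl
          (ιʳ z n) (ιⁱ z n) (ιʳ w n) (ιⁱ w n))
    }
  }
  where open +-*-Solver

-- The conjugate of `z` divided by `∣ z ∣²`: the factor hidden inside `_÷_⟨_⟩`, isolated so that
-- division becomes multiplication by a ring element.
reciprocal : ∀ z → Positiveᴿ ∣ z ∣² → ℂ
reciprocal z z#0 = (re z *ᴿ r) +i (-ᴿ (im z *ᴿ r))
  where r = recipᴿ ∣ z ∣² z#0

reciprocal-inverseˡ : ∀ z z#0 → reciprocal z z#0 *ᶜ z ≈ᶜ 1ᶜ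
reciprocal-inverseˡ z z#0@(ε , 0<ε , N , ε≤) =
  eventually-≡⇒≈ᴿ (re (u *ᶜ z)) (re 1ᶜ) N (λ n N≤n → ≡.trans
    (solve 3 (λ x y r → (x :* r) :* x :+ :- ((:- (y :* r)) :* y) := (x :* x :+ y :* y) :* r) ≡.refl
      (ιʳ z n) (ιⁱ z n) (seq r n))
    (recip-inverse (ℚ.<-≤-trans 0<ε (ε≤ n N≤n)))) ,
  ≗⇒≈ᴿ (im (u *ᶜ z)) (im 1ᶜ) (λ n →
    solve 3 (λ x y r → (x :* r) :* y :+ (:- (y :* r)) :* x := con 0ℚ) ≡.refl
      (ιʳ z n) (ιⁱ z n) (seq r n))
  where
  open +-*-Solver
  r = recipᴿ ∣ z ∣² z#0
  u = reciprocal z z#0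

÷≈*reciprocal : ∀ w z z#0 → w ÷ z ⟨ z#0 ⟩ ≈ᶜ w *ᶜ reciprocal z z#0
÷≈*reciprocal w z z#0 = ≗⇒≈ᶜ (w ÷ z ⟨ z#0 ⟩) (w *ᶜ reciprocal z z#0) (λ _ → ≡.refl) (λ _ → ≡.refl)

-- The embedding of ℕ in ℂ

fromℕ-mono-< : ∀ {m n} i j → m ℕ.< n → ιʳ (fromℕ m) i ℚ.< ιʳ (fromℕ n) j
fromℕ-mono-< {zero}  {suc zero}    i j _ = ℚ.positive⁻¹ _
fromℕ-mono-< {zero}  {suc (suc n)} i j _ = 0<+ 0<1 (fromℕ-mono-< {zero} {suc n} i j (ℕ.s≤s ℕ.z≤n))
fromℕ-mono-< {suc m} {suc n} i j (ℕ.s≤s m<n) = ℚ.+-monoʳ-< 1ℚ (fromℕ-mono-< i j m<n)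

fromℕ-const : ∀ m i j → ιʳ (fromℕ m) i ≡ ιʳ (fromℕ m) j
fromℕ-const zero    i j = ≡.refl
fromℕ-const (suc m) i j = cong (1ℚ ℚ.+_) (fromℕ-const m i j)

-- The sequences are constant, so their distance is one fixed positive rational; taking that
-- distance as ε contradicts equality.
fromℕ-≉ : ∀ {m n} → m ℕ.< n → ¬ (fromℕ m ≈ᶜ fromℕ n)
fromℕ-≉ {m} {n} m<n (r , _) = ℚ.<-irrefl distance (proj₂ (r (0<gap 0)) N ℕ.≤-refl)
  where
  gap : ℕ → ℚ
  gap i = ιʳ (fromℕ n) i ℚ.- ιʳ (fromℕ m) i
  0<gap : ∀ i → 0ℚ ℚ.< gap i
  0<gap i = subst (ℚ._< gap i) (ℚ.+-inverseʳ (ιʳ (fromℕ m) i))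
    (ℚ.+-monoˡ-< (ℚ.- ιʳ (fromℕ m) i) (fromℕ-mono-< i i m<n))
  N = proj₁ (r (0<gap 0))
  distance : ℚ.∣ ιʳ (fromℕ m) N ℚ.- ιʳ (fromℕ n) N ∣ ≡ gap 0
  distance = ≡.trans (∣p-q∣≡∣q-p∣ (ιʳ (fromℕ m) N) (ιʳ (fromℕ n) N))
    (≡.trans (ℚ.0≤p⇒∣p∣≡p (ℚ.<⇒≤ (0<gap N)))
      (cong₂ ℚ._-_ (fromℕ-const n N 0) (fromℕ-const m N 0)))

fromℕ-injective : ∀ {m n} → fromℕ m ≈ᶜ fromℕ n → m ≡ n
fromℕ-injective {m} {n} m≈n with ℕ.<-cmp m n
... | tri< m<n _ _ = contradiction m≈n (fromℕ-≉ m<n)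
... | tri≈ _ m≡n _ = m≡n
... | tri> _ _ n<m =
  contradiction (CommutativeRing.sym ℂ-commutativeRing {fromℕ m} {fromℕ n} m≈n) (fromℕ-≉ n<m)

-- Determinants

-- `pinch j i` is the position that `i` occupies once `punchIn i j` has been deleted.
punchIn-pinch : ∀ (i : Fin (suc n)) (j : Fin n) → punchIn (punchIn i j) (pinch j i) ≡ i
punchIn-pinch {suc n} zero    j       = ≡.refl
punchIn-pinch {suc n} (suc i) zero    = ≡.refl
punchIn-pinch {suc n} (suc i) (suc j) = cong suc (punchIn-pinch i j)

-- Two columns may be deleted in either order, with positions renumbered accordingly. This
-- identifies the double minors in the expansion along a lower row.
punchIn-punchIn : ∀ (i : Fin (suc (suc n))) (j : Fin (suc n)) (l : Fin n) →
                  punchIn (punchIn i j) (punchIn (pinch j i) l) ≡ punchIn i (punchIn j l)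
punchIn-punchIn zero    j       l       = ≡.refl
punchIn-punchIn (suc i) zero    l       = ≡.refl
punchIn-punchIn (suc i) (suc j) zero    = ≡.refl
punchIn-punchIn (suc i) (suc j) (suc l) = cong suc (punchIn-punchIn i j l)

element-∁⊥ : ∀ n → Σ (∣ ∁ (⊥ {n}) ∣ ≡ n) λ eq → ∀ i → element (∁ ⊥) i ≡ cast eq i
element-∁⊥ zero    = ≡.refl , λ ()
element-∁⊥ (suc n) with element-∁⊥ n
... | eq , el = cong suc eq , λ where
  zero    → ≡.refl
  (suc i) → cong suc (el i)

-- The deleted point belongs to `S`, so the complement loses nothing and is merely renumbered.
element-∁-removeAt : ∀ (S : Subset (suc n)) p → p ∈ₛ S →
  Σ (∣ ∁ (removeAt S p) ∣ ≡ ∣ ∁ S ∣) λ eq →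
    ∀ i → punchIn p (element (∁ (removeAt S p)) i) ≡ element (∁ S) (cast eq i)
element-∁-removeAt (_ ∷ S) zero here =
  ≡.refl , λ i → cong (λ i → suc (element (∁ S) i)) (≡.sym (Fin.cast-is-id ≡.refl i))
element-∁-removeAt (s ∷ S@(_ ∷ _)) (suc p) (there p∈S) with s | element-∁-removeAt S p p∈S
... | inside  | eq , el = eq , λ i → cong suc (el i)
... | outside | eq , el = cong suc eq , λ where
  zero    → ≡.refl
  (suc i) → cong suc (el i)

lookup-removeAt : ∀ (S : Subset (suc n)) p i → lookup (removeAt S p) i ≡ lookup S (punchIn p i)
lookup-removeAt (_ ∷ S)         zero    i       = ≡.refl
lookup-removeAt (_ ∷ S@(_ ∷ _)) (suc p) zero    = ≡.refl
lookup-removeAt (_ ∷ S@(_ ∷ _)) (suc p) (suc i) = lookup-removeAt S p i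

module Determinant {c ℓ} (K : CommutativeRing c ℓ) where
  open CommutativeRing K hiding (zero; _-_)
  open RawSemiringDefinitions (RawRing.rawSemiring rawRing) using (_^_)
  open SemiringSum semiring using (sum; sum-cong-≋; sum-remove; sum-replicate-zero; *-distribˡ-sum)
  open RingProperties ring using (-1*x≈-x; -‿involutive)
  open MatrixOps rawRing using (_≋_; 𝟙; det)
  open SemiringSolver commutativeSemiring using (solve; _:=_; _:*_; _:+_; con)
  open import Relation.Binary.Reasoning.Setoid setoid

  sgn : Fin n → Carrier
  sgn i = (- 1#) ^ toℕ i

  minor : Fin (suc n) → Fin (suc n) → Matrix Carrier (suc n) → Matrix Carrier n
  minor p q M i j = M (punchIn p i) (punchIn q j)

  -1*-1≈1 : - 1# * - 1# ≈ 1#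
  -1*-1≈1 = trans (-1*x≈-x (- 1#)) (-‿involutive 1#)

  -1^n*-1^n≈1 : ∀ n → (- 1#) ^ n * (- 1#) ^ n ≈ 1#
  -1^n*-1^n≈1 zero    = *-identityˡ 1#
  -1^n*-1^n≈1 (suc n) = begin
    (- 1# * s) * (- 1# * s) ≈⟨ solve 2 (λ m s → (m :* s) :* (m :* s) := (m :* m) :* (s :* s)) refl (- 1#) s ⟩
    (- 1# * - 1#) * (s * s) ≈⟨ *-cong -1*-1≈1 (-1^n*-1^n≈1 n) ⟩
    1# * 1#                 ≈⟨ *-identityˡ 1# ⟩
    1#                      ∎
    where s = (- 1#) ^ n

  sum-zero : ∀ {n} {t : Fin n → Carrier} → (∀ i → t i ≈ 0#) → sum t ≈ 0#
  sum-zero {n} t≈0 = trans (sum-cong-≋ t≈0) (sum-replicate-zero n)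

  det-cong : ∀ {n} {M N : Matrix Carrier n} → M ≋ N → det M ≈ det N
  det-cong {zero}  M≋N = refl
  det-cong {suc n} M≋N = sum-cong-≋ λ j →
    *-congˡ {sgn j} (*-cong (M≋N zero j) (det-cong (λ i l → M≋N (suc i) (punchIn j l))))

  det-cast : ∀ {M : Matrix Carrier m} {N : Matrix Carrier n} (eq : m ≡ n) →
             (∀ i j → M i j ≈ N (cast eq i) (cast eq j)) → det M ≈ det N
  det-cast {N = N} ≡.refl M≋N = det-cong λ i j → trans (M≋N i j)
    (reflexive (cong₂ N (Fin.cast-is-id ≡.refl i) (Fin.cast-is-id ≡.refl j)))

  det-neg : ∀ {n} (M : Matrix Carrier n) → det (λ i j → - M i j) ≈ (- 1#) ^ n * det M
  det-neg {zero}  M = sym (*-identityˡ 1#)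
  det-neg {suc n} M = begin
    sum (λ j → sgn j * (- M zero j * det (λ i l → - minor zero j M i l)))
      ≈⟨ sum-cong-≋ (λ j → *-congˡ {sgn j} (*-cong (sym (-1*x≈-x (M zero j))) (det-neg (minor zero j M)))) ⟩
    sum (λ j → sgn j * ((- 1# * M zero j) * ((- 1#) ^ n * det (minor zero j M))))
      ≈⟨ sum-cong-≋ (λ j → solve 5 (λ s m a p d → s :* ((m :* a) :* (p :* d)) := (m :* p) :* (s :* (a :* d)))
           refl (sgn j) (- 1#) (M zero j) ((- 1#) ^ n) (det (minor zero j M))) ⟩
    sum (λ j → (- 1#) ^ suc n * (sgn j * (M zero j * det (minor zero j M))))
      ≈⟨ *-distribˡ-sum ((- 1#) ^ suc n) (λ j → sgn j * (M zero j * det (minor zero j M))) ⟨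
    (- 1#) ^ suc n * det M ∎

  z≈0⇒x[yz]≈0 : ∀ x y {z} → z ≈ 0# → x * (y * z) ≈ 0#
  z≈0⇒x[yz]≈0 x y z≈0 = trans (*-congˡ (trans (*-congˡ z≈0) (zeroʳ y))) (zeroʳ x)

  y≈0⇒x[yz]≈0 : ∀ x {y} z → y ≈ 0# → x * (y * z) ≈ 0#
  y≈0⇒x[yz]≈0 x z y≈0 = trans (*-congˡ (trans (*-congʳ y≈0) (zeroˡ z))) (zeroʳ x)

  det-zero-row : ∀ {n} (M : Matrix Carrier n) p → (∀ j → M p j ≈ 0#) → det M ≈ 0#
  det-zero-row {suc n} M zero    Mp≈0 = sum-zero λ j →
    y≈0⇒x[yz]≈0 (sgn j) (det (minor zero j M)) (Mp≈0 j)
  det-zero-row {suc n} M (suc p) Mp≈0 = sum-zero λ j →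
    z≈0⇒x[yz]≈0 (sgn j) (M zero j) (det-zero-row (minor zero j M) p (λ l → Mp≈0 (punchIn j l)))

  -- Exchanging the order of two deletions shifts exactly one of the two positions, by one: either
  -- `j` moves up past `i`, or `i` moves down past `j`. The parity of their sum therefore flips.
  sgn-punchIn-pinch : ∀ (i : Fin (suc n)) (j : Fin n) →
                      sgn (punchIn i j) * sgn (pinch j i) ≈ - 1# * (sgn i * sgn j)
  sgn-punchIn-pinch {suc n} zero j =
    solve 2 (λ m s → (m :* s) :* con 1 := m :* (con 1 :* s)) refl (- 1#) (sgn j)
  sgn-punchIn-pinch {suc n} (suc i) zero = begin
    1# * sgn i                           ≈⟨ *-congʳ -1*-1≈1 ⟨
    (- 1# * - 1#) * sgn i                ≈⟨ solve 2 (λ m s → (m :* m) :* s := m :* ((m :* s) :* con 1))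
                                              refl (- 1#) (sgn i) ⟩
    - 1# * ((- 1# * sgn i) * 1#)         ∎
  sgn-punchIn-pinch {suc n} (suc i) (suc j) = begin
    (- 1# * a) * (- 1# * b)                      ≈⟨ solve 3 (λ m a b → (m :* a) :* (m :* b) :=
                                                      (m :* m) :* (a :* b)) refl (- 1#) a b ⟩
    (- 1# * - 1#) * (a * b)                      ≈⟨ *-congˡ (sgn-punchIn-pinch i j) ⟩
    (- 1# * - 1#) * (- 1# * (sgn i * sgn j))     ≈⟨ solve 3 (λ m a b → (m :* m) :* (m :* (a :* b)) :=
                                                      m :* ((m :* a) :* (m :* b))) refl (- 1#) (sgn i) (sgn j) ⟩
    - 1# * ((- 1# * sgn i) * (- 1# * sgn j))     ∎
    where
    a = sgn (punchIn i j)
    b = sgn (pinch j i)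

  -- `det` expands along the first row only. For a lower row, induction applies to each first-row
  -- minor: the row still has at most one nonzero entry there, and it is zero altogether when column
  -- `q` is the one removed.
  det-single-entry-row : ∀ (M : Matrix Carrier (suc n)) p q → (∀ j → M p (punchIn q j) ≈ 0#) →
                         det M ≈ (sgn p * sgn q) * (M p q * det (minor p q M))
  det-single-entry-row M zero q Mp≈0 = begin
    det M
      ≈⟨ sum-remove {i = q} (λ j → sgn j * (M zero j * det (minor zero j M))) ⟩
    t q + sum (λ j → t (punchIn q j))
      ≈⟨ +-congˡ (sum-zero λ j →
           y≈0⇒x[yz]≈0 (sgn (punchIn q j)) (det (minor zero (punchIn q j) M)) (Mp≈0 j)) ⟩
    t q + 0#
      ≈⟨ solve 2 (λ s x → s :* x :+ con 0 := (con 1 :* s) :* x) refl (sgn q) (M zero q * det (minor zero q M)) ⟩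
    (1# * sgn q) * (M zero q * det (minor zero q M)) ∎
    where
    t : Fin _ → Carrier
    t j = sgn j * (M zero j * det (minor zero j M))
  det-single-entry-row {suc n} M (suc p) q Mp≈0 = begin
    det M
      ≈⟨ sum-remove {i = q} t ⟩
    t q + sum (λ j → t (punchIn q j))
      ≈⟨ +-cong vanishes (sum-cong-≋ expand) ⟩
    0# + sum (λ j → (sgn (suc p) * sgn q) * (M (suc p) q * (sgn j * (M zero (punchIn q j) * d j))))
      ≈⟨ +-identityˡ _ ⟩
    sum (λ j → (sgn (suc p) * sgn q) * (M (suc p) q * (sgn j * (M zero (punchIn q j) * d j))))
      ≈⟨ *-distribˡ-sum (sgn (suc p) * sgn q) (λ j → M (suc p) q * (sgn j * (M zero (punchIn q j) * d j))) ⟨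
    (sgn (suc p) * sgn q) * sum (λ j → M (suc p) q * (sgn j * (M zero (punchIn q j) * d j)))
      ≈⟨ *-congˡ (*-distribˡ-sum (M (suc p) q) (λ j → sgn j * (M zero (punchIn q j) * d j))) ⟨
    (sgn (suc p) * sgn q) * (M (suc p) q * det (minor (suc p) q M)) ∎
    where
    t : Fin _ → Carrier
    t j = sgn j * (M zero j * det (minor zero j M))
    d : Fin _ → Carrier
    d j = det (minor zero j (minor (suc p) q M))
    vanishes : t q ≈ 0#
    vanishes = z≈0⇒x[yz]≈0 (sgn q) (M zero q) (det-zero-row (minor zero q M) p Mp≈0)
    minor-row≈0 : ∀ j l → M (suc p) (punchIn (punchIn q j) (punchIn (pinch j q) l)) ≈ 0#
    minor-row≈0 j l = trans (reflexive (cong (M (suc p)) (punchIn-punchIn q j l))) (Mp≈0 (punchIn j l))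
    expand : ∀ j → t (punchIn q j) ≈
             (sgn (suc p) * sgn q) * (M (suc p) q * (sgn j * (M zero (punchIn q j) * d j)))
    expand j = begin
      s * (w * det (minor zero (punchIn q j) M))
        ≈⟨ *-congˡ {s} (*-congˡ {w}
             (det-single-entry-row (minor zero (punchIn q j) M) p (pinch j q) (minor-row≈0 j))) ⟩
      s * (w * ((sgn p * s′) * (M (suc p) (punchIn (punchIn q j) (pinch j q))
                                 * det (minor p (pinch j q) (minor zero (punchIn q j) M)))))
        ≈⟨ *-congˡ {s} (*-congˡ {w} (*-congˡ {sgn p * s′} (*-cong
             (reflexive (cong (M (suc p)) (punchIn-pinch q j)))
             (det-cong λ i l → reflexive (cong (M (suc (punchIn p i))) (punchIn-punchIn q j l)))))) ⟩
      s * (w * ((sgn p * s′) * (M (suc p) q * d j)))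
        ≈⟨ solve 6 (λ s w sp s′ x d → s :* (w :* ((sp :* s′) :* (x :* d)))
             := (s :* s′) :* ((sp :* x) :* (w :* d))) refl s w (sgn p) s′ (M (suc p) q) (d j) ⟩
      (s * s′) * ((sgn p * M (suc p) q) * (w * d j))
        -- The factor -1 from exchanging the deletions turns the sign of row `p` of the minor into
        -- the sign of row `suc p` of `M`.
        ≈⟨ *-congʳ (sgn-punchIn-pinch q j) ⟩
      (- 1# * (sgn q * sgn j)) * ((sgn p * M (suc p) q) * (w * d j))
        ≈⟨ solve 7 (λ m sq sj sp x w d → (m :* (sq :* sj)) :* ((sp :* x) :* (w :* d))
             := ((m :* sp) :* sq) :* (x :* (sj :* (w :* d)))) refl
             (- 1#) (sgn q) (sgn j) (sgn p) (M (suc p) q) w (d j) ⟩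
      (sgn (suc p) * sgn q) * (M (suc p) q * (sgn j * (w * d j))) ∎
      where
      s = sgn (punchIn q j)
      s′ = sgn (pinch j q)
      w = M zero (punchIn q j)

  mix : Subset n → Matrix Carrier n → Matrix Carrier n → Matrix Carrier n
  mix S N B i j = if lookup S i then B i j else N i j

  𝟙-diagonal : ∀ (i : Fin n) → 𝟙 i i ≡ 1#
  𝟙-diagonal i = cong (λ b → if b then 1# else 0#) (dec-true (i Fin.≟ i) ≡.refl)

  𝟙-off-diagonal : ∀ {i j : Fin n} → i ≢ j → 𝟙 i j ≡ 0#
  𝟙-off-diagonal {i = i} {j} i≢j = cong (λ b → if b then 1# else 0#) (dec-false (i Fin.≟ j) i≢j)

  𝟙-punchIn : ∀ p (i j : Fin n) → 𝟙 (punchIn p i) (punchIn p j) ≡ 𝟙 i j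
  𝟙-punchIn p i j with i Fin.≟ j
  ... | yes ≡.refl = 𝟙-diagonal (punchIn p i)
  ... | no i≢j     = 𝟙-off-diagonal (λ eq → i≢j (Fin.punchIn-injective p i j eq))

  -- A point `p` of `S` makes row `p` a unit row, so the determinant reduces to the minor at (p, p),
  -- whose sign is a square and hence 1. The minor has the same shape with `p` removed from `S`, and
  -- the induction ends when `S` is empty.
  det-mix-𝟙 : ∀ {n} (S : Subset n) (N : Matrix Carrier n) → det (mix S N 𝟙) ≈ det (N [ ∁ S ])
  det-mix-𝟙 {zero}  []  N = refl
  det-mix-𝟙 {suc n} S N with nonempty? S
  -- The complement is now everything, but its size equals `suc n` only propositionally, so the
  -- indices have to be cast.
  ... | no S-empty = sym (det-cast {M = N [ ∁ S ]} {N = mix S N 𝟙} (proj₁ el) entries)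
    where
    el : Σ (∣ ∁ S ∣ ≡ suc n) λ eq → ∀ i → element (∁ S) i ≡ cast eq i
    el = ≡.subst (λ S → Σ (∣ ∁ S ∣ ≡ suc n) λ eq → ∀ i → element (∁ S) i ≡ cast eq i)
           (≡.sym (Empty-unique S-empty)) (element-∁⊥ (suc n))
    outside-S : ∀ i → lookup S i ≡ outside
    outside-S i with lookup S i in eq
    ... | outside = ≡.refl
    ... | inside  = contradiction (i , Vec.lookup⇒[]= i S eq) S-empty
    entries : ∀ i j → (N [ ∁ S ]) i j ≈ mix S N 𝟙 (cast (proj₁ el) i) (cast (proj₁ el) j)
    entries i j = reflexive (≡.trans (cong₂ N (proj₂ el i) (proj₂ el j))
      (≡.sym (cong (λ b → if b then 𝟙 i′ j′ else N i′ j′) (outside-S i′))))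
      where
      i′ = cast (proj₁ el) i
      j′ = cast (proj₁ el) j
  ... | yes (p , p∈S) = begin
    det (mix S N 𝟙)
      ≈⟨ det-single-entry-row (mix S N 𝟙) p p (λ j → reflexive (≡.trans (mix-p (punchIn p j))
           (𝟙-off-diagonal (λ eq → Fin.punchInᵢ≢i p j (≡.sym eq))))) ⟩
    (sgn p * sgn p) * (mix S N 𝟙 p p * det (minor p p (mix S N 𝟙)))
      ≈⟨ *-cong (-1^n*-1^n≈1 (toℕ p))
           (*-cong (reflexive (≡.trans (mix-p p) (𝟙-diagonal p))) (det-cong mix-minor)) ⟩
    1# * (1# * det (mix (removeAt S p) (minor p p N) 𝟙))
      ≈⟨ trans (*-identityˡ _) (*-identityˡ _) ⟩
    det (mix (removeAt S p) (minor p p N) 𝟙)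
      ≈⟨ det-mix-𝟙 (removeAt S p) (minor p p N) ⟩
    det (minor p p N [ ∁ (removeAt S p) ])
      ≈⟨ det-cast (proj₁ el) (λ i j → reflexive (cong₂ N (proj₂ el i) (proj₂ el j))) ⟩
    det (N [ ∁ S ]) ∎
    where
    el = element-∁-removeAt S p p∈S
    mix-p : ∀ j → mix S N 𝟙 p j ≡ 𝟙 p j
    mix-p j = cong (λ b → if b then 𝟙 p j else N p j) (Vec.[]=⇒lookup p∈S)
    mix-minor : minor p p (mix S N 𝟙) ≋ mix (removeAt S p) (minor p p N) 𝟙
    mix-minor i j = reflexive (cong₂ (λ b x → if b then x else N (punchIn p i) (punchIn p j))
      (≡.sym (lookup-removeAt S p i)) (𝟙-punchIn p i j))

-- Sums over k-subsets

subsets : ∀ n → ℕ → List (Subset n)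
subsets zero    zero    = [] ∷ []
subsets zero    (suc k) = []
subsets (suc n) zero    = List.map (outside ∷_) (subsets n zero)
subsets (suc n) (suc k) =
  List.map (outside ∷_) (subsets n (suc k)) ++ List.map (inside ∷_) (subsets n k)

∈-subsets⁺ : ∀ {k} (α : Subset n) → ∣ α ∣ ≡ k → α List.∈ subsets n k
∈-subsets⁺ {k = zero}  []            _  = here ≡.refl
∈-subsets⁺ {k = zero}  (outside ∷ α) eq = ∈-map⁺ (outside ∷_) (∈-subsets⁺ α eq)
∈-subsets⁺ {k = suc k} (outside ∷ α) eq = ∈-++⁺ˡ (∈-map⁺ (outside ∷_) (∈-subsets⁺ α eq))
∈-subsets⁺ {k = suc k} (inside  ∷ α) eq =
  ∈-++⁺ʳ _ (∈-map⁺ (inside ∷_) (∈-subsets⁺ α (ℕ.suc-injective eq)))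

∈-subsets⁻ : ∀ {n} k {α : Subset n} → α List.∈ subsets n k → ∣ α ∣ ≡ k
∈-subsets⁻ {zero}  zero    (here ≡.refl) = ≡.refl
∈-subsets⁻ {suc n} zero    α∈ with ∈-map⁻ (outside ∷_) α∈
... | _ , β∈ , ≡.refl = ∈-subsets⁻ zero β∈
∈-subsets⁻ {suc n} (suc k) α∈ with ∈-++⁻ (List.map (outside ∷_) (subsets n (suc k))) α∈
... | inj₁ α∈ˡ with ∈-map⁻ (outside ∷_) α∈ˡ
...   | _ , β∈ , ≡.refl = ∈-subsets⁻ (suc k) β∈
∈-subsets⁻ {suc n} (suc k) α∈ | inj₂ α∈ʳ with ∈-map⁻ (inside ∷_) α∈ʳ
...   | _ , β∈ , ≡.refl = cong suc (∈-subsets⁻ k β∈)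

subsets-unique : ∀ n k → Unique (subsets n k)
subsets-unique zero    zero    = [] ∷ []
subsets-unique zero    (suc k) = []
subsets-unique (suc n) zero    = Unique.map⁺ Vec.∷-injectiveʳ (subsets-unique n zero)
subsets-unique (suc n) (suc k) = Unique.++⁺
  (Unique.map⁺ Vec.∷-injectiveʳ (subsets-unique n (suc k)))
  (Unique.map⁺ Vec.∷-injectiveʳ (subsets-unique n k))
  λ (∈ˡ , ∈ʳ) → disjoint (∈-map⁻ (outside ∷_) ∈ˡ) (∈-map⁻ (inside ∷_) ∈ʳ)
  where
  disjoint : ∀ {α : Subset (suc n)} {xs ys} → (∃[ β ] β List.∈ xs × α ≡ outside ∷ β) →
             ¬ (∃[ β ] β List.∈ ys × α ≡ inside ∷ β)
  disjoint (_ , _ , ≡.refl) (_ , _ , ())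

subsets-empty : ∀ {n k} → n ℕ.< k → subsets n k ≡ []
subsets-empty {zero}  {suc k} _            = ≡.refl
subsets-empty {suc n} {suc k} (ℕ.s≤s n<k)
  rewrite subsets-empty {n} {suc k} (ℕ.m<n⇒m<1+n n<k) | subsets-empty n<k = ≡.refl

embed : (α : Subset n) → Subset ∣ α ∣ → Subset n
embed []            γ       = []
embed (outside ∷ α) γ       = outside ∷ embed α γ
embed (inside  ∷ α) (s ∷ γ) = s ∷ embed α γ

-- This makes a principal submatrix of `A [ α ]` a principal submatrix of `A`, up to a cast of
-- indices.
element-embed : (α : Subset n) (γ : Subset ∣ α ∣) →
  Σ (∣ γ ∣ ≡ ∣ embed α γ ∣) λ eq → ∀ i → element α (element γ i) ≡ element (embed α γ) (cast eq i)
element-embed []            []            = ≡.refl , λ ()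
element-embed (outside ∷ α) γ             with element-embed α γ
... | eq , el = eq , λ i → cong suc (el i)
element-embed (inside  ∷ α) (outside ∷ γ) with element-embed α γ
... | eq , el = eq , λ i → cong suc (el i)
element-embed (inside  ∷ α) (inside  ∷ γ) with element-embed α γ
... | eq , el = cong suc eq , λ where
  zero    → ≡.refl
  (suc i) → cong suc (el i)

-- The exponent in `coeff` is the size of `A [ ∁ α ]` minus `k`, which is why the coefficient is
-- made of minors of order `k` whatever the size of `α`.
n-k-∣α∣≡∣∁α∣-k : ∀ (α : Subset n) k → + n ℤ.- + k ℤ.- + ∣ α ∣ ≡ + ∣ ∁ α ∣ ℤ.- + k
n-k-∣α∣≡∣∁α∣-k {n} α k = begin
  + n ℤ.- + k ℤ.- + ∣ α ∣              ≡⟨ ℤ.+-assoc (+ n) (ℤ.- + k) (ℤ.- + ∣ α ∣) ⟩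
  + n ℤ.+ (ℤ.- + k ℤ.- + ∣ α ∣)        ≡⟨ cong (λ z → + n ℤ.+ z) (ℤ.+-comm (ℤ.- + k) (ℤ.- + ∣ α ∣)) ⟩
  + n ℤ.+ (ℤ.- + ∣ α ∣ ℤ.- + k)        ≡⟨ ℤ.+-assoc (+ n) (ℤ.- + ∣ α ∣) (ℤ.- + k) ⟨
  + n ℤ.- + ∣ α ∣ ℤ.- + k              ≡⟨ cong (λ z → z ℤ.- + k) (ℤ.m-n≡m⊖n n ∣ α ∣) ⟩
  n ℤ.⊖ ∣ α ∣ ℤ.- + k                  ≡⟨ cong (λ z → z ℤ.- + k) (ℤ.⊖-≥ (Subset.∣p∣≤n α)) ⟩
  + (n ℕ.∸ ∣ α ∣) ℤ.- + k              ≡⟨ cong (λ m → + m ℤ.- + k) (Subset.∣∁p∣≡n∸∣p∣ α) ⟨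
  + ∣ ∁ α ∣ ℤ.- + k                    ∎
  where open ≡.≡-Reasoning

module SubsetSum {c ℓ} (K : CommutativeRing c ℓ) where
  open CommutativeRing K hiding (zero; _-_)
  open SemiringMult semiring using (×-congˡ; ×-homo-+) renaming (_×_ to _·_)
  open SemiringSolver commutativeSemiring using (solve; _:=_; _:*_; _:+_; con)
  open import Relation.Binary.Reasoning.Setoid setoid

  ∑ : ∀ {a} {X : Set a} → List X → (X → Carrier) → Carrier
  ∑ xs f = foldr (λ x s → f x + s) 0# xs

  module _ {a} {X : Set a} where

    ∑-cong : ∀ (xs : List X) {f g : X → Carrier} → (∀ x → x List.∈ xs → f x ≈ g x) → ∑ xs f ≈ ∑ xs g
    ∑-cong []       f≈g = refl
    ∑-cong (x ∷ xs) f≈g = +-cong (f≈g x (here ≡.refl)) (∑-cong xs (λ y y∈xs → f≈g y (there y∈xs)))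

    ∑-zero : ∀ (xs : List X) → ∑ xs (λ _ → 0#) ≈ 0#
    ∑-zero []       = refl
    ∑-zero (x ∷ xs) = trans (+-identityˡ _) (∑-zero xs)

    ∑-++ : ∀ xs ys (f : X → Carrier) → ∑ (xs ++ ys) f ≈ ∑ xs f + ∑ ys f
    ∑-++ []       ys f = sym (+-identityˡ _)
    ∑-++ (x ∷ xs) ys f = trans (+-congˡ (∑-++ xs ys f)) (sym (+-assoc _ _ _))

    ∑-+ : ∀ xs (f g : X → Carrier) → ∑ xs f + ∑ xs g ≈ ∑ xs (λ x → f x + g x)
    ∑-+ []       f g = +-identityˡ 0#
    ∑-+ (x ∷ xs) f g = trans
      (solve 4 (λ a b c d → (a :+ b) :+ (c :+ d) := (a :+ c) :+ (b :+ d)) refl _ _ _ _)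
      (+-congˡ (∑-+ xs f g))

    ∑-* : ∀ xs y (f : X → Carrier) → y * ∑ xs f ≈ ∑ xs (λ x → y * f x)
    ∑-* []       y f = zeroʳ y
    ∑-* (x ∷ xs) y f = trans (distribˡ y _ _) (+-congˡ (∑-* xs y f))

    ∑-map : ∀ {b} {Y : Set b} (h : Y → X) ys (f : X → Carrier) →
            ∑ (List.map h ys) f ≡ ∑ ys (λ y → f (h y))
    ∑-map h []       f = ≡.refl
    ∑-map h (y ∷ ys) f = cong (λ s → f (h y) + s) (∑-map h ys f)

  ∑-subsets-zero : ∀ n (f : Subset (suc n) → Carrier) →
    ∑ (subsets (suc n) zero) f ≈ ∑ (subsets n zero) (λ α → f (outside ∷ α))
  ∑-subsets-zero n f = reflexive (∑-map (outside ∷_) (subsets n zero) f)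

  ∑-subsets-suc : ∀ n k (f : Subset (suc n) → Carrier) →
    ∑ (subsets (suc n) (suc k)) f ≈
    ∑ (subsets n (suc k)) (λ α → f (outside ∷ α)) + ∑ (subsets n k) (λ α → f (inside ∷ α))
  ∑-subsets-suc n k f = trans
    (∑-++ (List.map (outside ∷_) (subsets n (suc k))) (List.map (inside ∷_) (subsets n k)) f)
    (reflexive (cong₂ _+_ (∑-map (outside ∷_) (subsets n (suc k)) f)
                          (∑-map (inside ∷_) (subsets n k) f)))

  ∑-subsets-empty : ∀ {n k} → n ℕ.< k → (f : Subset n → Carrier) → ∑ (subsets n k) f ≈ 0#
  ∑-subsets-empty n<k f = reflexive (cong (λ xs → ∑ xs f) (subsets-empty n<k))

  -- Complementation exchanges the subsets with and without the first point, so the two halves of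
  -- the recursion for `subsets` trade places.
  ∑-∁ : ∀ n m k → m ℕ.+ k ≡ n → (f : Subset n → Carrier) →
        ∑ (subsets n m) (λ α → f (∁ α)) ≈ ∑ (subsets n k) f
  ∑-∁ zero    zero    zero    _  f = refl
  ∑-∁ (suc n) zero    (suc k) eq f = begin
    ∑ (subsets (suc n) zero) (λ α → f (∁ α))
      ≈⟨ ∑-subsets-zero n (λ α → f (∁ α)) ⟩
    ∑ (subsets n zero) (λ α → f (inside ∷ ∁ α))
      ≈⟨ ∑-∁ n zero k (ℕ.suc-injective eq) (λ α → f (inside ∷ α)) ⟩
    ∑ (subsets n k) (λ α → f (inside ∷ α))
      ≈⟨ +-identityˡ _ ⟨
    0# + ∑ (subsets n k) (λ α → f (inside ∷ α))
      ≈⟨ +-congʳ (∑-subsets-empty (ℕ.≤-reflexive (≡.sym eq)) (λ α → f (outside ∷ α))) ⟨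
    ∑ (subsets n (suc k)) (λ α → f (outside ∷ α)) + ∑ (subsets n k) (λ α → f (inside ∷ α))
      ≈⟨ ∑-subsets-suc n k f ⟨
    ∑ (subsets (suc n) (suc k)) f ∎
  ∑-∁ (suc n) (suc m) zero    eq f = begin
    ∑ (subsets (suc n) (suc m)) (λ α → f (∁ α))
      ≈⟨ ∑-subsets-suc n m (λ α → f (∁ α)) ⟩
    ∑ (subsets n (suc m)) (λ α → f (inside ∷ ∁ α)) + ∑ (subsets n m) (λ α → f (outside ∷ ∁ α))
      ≈⟨ +-cong (∑-subsets-empty (ℕ.≤-reflexive (≡.trans (≡.sym eq) (ℕ.+-identityʳ (suc m))))
                  (λ α → f (inside ∷ ∁ α)))
                (∑-∁ n m zero (ℕ.suc-injective eq) (λ α → f (outside ∷ α))) ⟩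
    0# + ∑ (subsets n zero) (λ α → f (outside ∷ α))
      ≈⟨ +-identityˡ _ ⟩
    ∑ (subsets n zero) (λ α → f (outside ∷ α))
      ≈⟨ ∑-subsets-zero n f ⟨
    ∑ (subsets (suc n) zero) f ∎
  ∑-∁ (suc n) (suc m) (suc k) eq f = begin
    ∑ (subsets (suc n) (suc m)) (λ α → f (∁ α))
      ≈⟨ ∑-subsets-suc n m (λ α → f (∁ α)) ⟩
    ∑ (subsets n (suc m)) (λ α → f (inside ∷ ∁ α)) + ∑ (subsets n m) (λ α → f (outside ∷ ∁ α))
      ≈⟨ +-cong (∑-∁ n (suc m) k (≡.trans (≡.sym (ℕ.+-suc m k)) (ℕ.suc-injective eq)) (λ α → f (inside ∷ α)))
                (∑-∁ n m (suc k) (ℕ.suc-injective eq) (λ α → f (outside ∷ α))) ⟩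
    ∑ (subsets n k) (λ α → f (inside ∷ α)) + ∑ (subsets n (suc k)) (λ α → f (outside ∷ α))
      ≈⟨ +-comm _ _ ⟩
    ∑ (subsets n (suc k)) (λ α → f (outside ∷ α)) + ∑ (subsets n k) (λ α → f (inside ∷ α))
      ≈⟨ ∑-subsets-suc n k f ⟨
    ∑ (subsets (suc n) (suc k)) f ∎

  -- Containment is an indicator inside a sum over all k-subsets, so that sums for different `α`
  -- share one index list and can be added term by term.
  ∑⊆ : ℕ → (Subset n → Carrier) → Subset n → Carrier
  ∑⊆ k f α = ∑ (subsets _ k) (λ β → if does (β ⊆? α) then f β else 0#)

  ∑-embed : ∀ {n} (α : Subset n) k (f : Subset n → Carrier) →
            ∑ (subsets ∣ α ∣ k) (λ γ → f (embed α γ)) ≈ ∑⊆ k f α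
  ∑-embed []            zero    f = refl
  ∑-embed []            (suc k) f = refl
  ∑-embed {suc n} (outside ∷ α) zero    f =
    trans (∑-embed α zero (λ β → f (outside ∷ β))) (sym (∑-subsets-zero n _))
  ∑-embed {suc n} (outside ∷ α) (suc k) f = begin
    ∑ (subsets ∣ α ∣ (suc k)) (λ γ → f (outside ∷ embed α γ))
      ≈⟨ ∑-embed α (suc k) (λ β → f (outside ∷ β)) ⟩
    ∑ (subsets n (suc k)) (λ β → if does (β ⊆? α) then f (outside ∷ β) else 0#)
      ≈⟨ +-identityʳ _ ⟨
    ∑ (subsets n (suc k)) (λ β → if does (β ⊆? α) then f (outside ∷ β) else 0#) + 0#
      ≈⟨ +-congˡ (∑-zero (subsets n k)) ⟨
    ∑ (subsets n (suc k)) (λ β → if does (β ⊆? α) then f (outside ∷ β) else 0#)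
      + ∑ (subsets n k) (λ _ → 0#)
      ≈⟨ ∑-subsets-suc n k (λ β → if does (β ⊆? (outside ∷ α)) then f β else 0#) ⟨
    ∑ (subsets (suc n) (suc k)) (λ β → if does (β ⊆? (outside ∷ α)) then f β else 0#) ∎
  ∑-embed {suc n} (inside  ∷ α) zero    f = trans (∑-subsets-zero ∣ α ∣ _)
    (trans (∑-embed α zero (λ β → f (outside ∷ β))) (sym (∑-subsets-zero n _)))
  ∑-embed {suc n} (inside  ∷ α) (suc k) f = trans (∑-subsets-suc ∣ α ∣ k _)
    (trans (+-cong (∑-embed α (suc k) (λ β → f (outside ∷ β))) (∑-embed α k (λ β → f (inside ∷ β))))
      (sym (∑-subsets-suc n k _)))

  ∑-subsets-1 : ∀ n k → ∑ (subsets n k) (λ _ → 1#) ≈ (n C k) · 1#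
  ∑-subsets-1 zero    zero    = refl
  ∑-subsets-1 zero    (suc k) = refl
  ∑-subsets-1 (suc n) zero    = trans (∑-subsets-zero n _) (∑-subsets-1 n zero)
  ∑-subsets-1 (suc n) (suc k) = begin
    ∑ (subsets (suc n) (suc k)) (λ _ → 1#)     ≈⟨ ∑-subsets-suc n k _ ⟩
    ∑ (subsets n (suc k)) (λ _ → 1#) + ∑ (subsets n k) (λ _ → 1#)
                                               ≈⟨ +-cong (∑-subsets-1 n (suc k)) (∑-subsets-1 n k) ⟩
    (n C suc k) · 1# + (n C k) · 1#            ≈⟨ +-comm _ _ ⟩
    (n C k) · 1# + (n C suc k) · 1#            ≈⟨ ×-homo-+ 1# (n C k) (n C suc k) ⟨
    (n C k ℕ.+ n C suc k) · 1#                 ≈⟨ ×-congˡ (nCk+nC[k+1]≡[n+1]C[k+1] n k) ⟩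
    (suc n C suc k) · 1#                       ∎

-- Coefficients of characteristic polynomials

module CharPoly {c ℓ} (R : RawRing c ℓ) (isCommutativeRing : IsCommutativeRing
  (RawRing._≈_ R) (RawRing._+_ R) (RawRing._*_ R) (RawRing.-_ R) (RawRing.0# R) (RawRing.1# R)) where
  K : CommutativeRing c ℓ
  K = record { RawRing R ; isCommutativeRing = isCommutativeRing }
  open CommutativeRing K hiding (zero; _-_; isCommutativeRing)
  open RawSemiringDefinitions (RawRing.rawSemiring rawRing) using (_^_)
  open SemiringSum semiring using (sum; sum-cong-≋; *-distribˡ-sum; ∑-distrib-+)
  open MatrixOps rawRing using (𝟙; det)
  open Polynomial R
  open Determinant K
  open SubsetSum K
  open SemiringSolver commutativeSemiring using (solve; _:=_; _:*_; _:+_; con)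
  open import Relation.Binary.Reasoning.Setoid setoid

  open MatrixOps poly-rawRing using () renaming (det to detₚ; 𝟙 to 𝟙ₚ)
  open RawSemiringDefinitions (RawRing.rawSemiring poly-rawRing) using () renaming (sum to sumₚ; _^_ to _^ₚ_)

  coefficient-+ : ∀ p q m → coefficient (p +ₚ q) m ≈ coefficient p m + coefficient q m
  coefficient-+ []      q       m       = sym (+-identityˡ _)
  coefficient-+ (a ∷ p) []      m       = sym (+-identityʳ _)
  coefficient-+ (a ∷ p) (b ∷ q) zero    = refl
  coefficient-+ (a ∷ p) (b ∷ q) (suc m) = coefficient-+ p q m

  coefficient-sum : ∀ {n} (t : Fin n → Poly) m → coefficient (sumₚ t) m ≈ sum (λ i → coefficient (t i) m)
  coefficient-sum {zero}  t m = refl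
  coefficient-sum {suc n} t m =
    trans (coefficient-+ (t zero) _ m) (+-congˡ (coefficient-sum (λ i → t (suc i)) m))

  coefficient-scale : ∀ a q m → coefficient (List.map (a *_) q) m ≈ a * coefficient q m
  coefficient-scale a []      m       = sym (zeroʳ a)
  coefficient-scale a (b ∷ q) zero    = refl
  coefficient-scale a (b ∷ q) (suc m) = coefficient-scale a q m

  coefficient-constant-* : ∀ a q m → coefficient (constant a *ₚ q) m ≈ a * coefficient q m
  coefficient-constant-* a q m = begin
    coefficient (List.map (a *_) q +ₚ (0# ∷ [])) m ≈⟨ coefficient-+ (List.map (a *_) q) (0# ∷ []) m ⟩
    coefficient (List.map (a *_) q) m + coefficient (0# ∷ []) m
                                                    ≈⟨ +-cong (coefficient-scale a q m) (0-coefficient m) ⟩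
    a * coefficient q m + 0#                        ≈⟨ +-identityʳ _ ⟩
    a * coefficient q m                             ∎
    where
    0-coefficient : ∀ m → coefficient (0# ∷ []) m ≈ 0#
    0-coefficient zero    = refl
    0-coefficient (suc m) = refl

  coefficient-linear-* : ∀ a b q m →
    coefficient ((a ∷ b ∷ []) *ₚ q) m ≈ a * coefficient q m + b * coefficient (0# ∷ q) m
  coefficient-linear-* a b q m = trans (coefficient-+ (List.map (a *_) q) (0# ∷ (constant b *ₚ q)) m)
    (+-cong (coefficient-scale a q m) (shifted m))
    where
    shifted : ∀ m → coefficient (0# ∷ (constant b *ₚ q)) m ≈ b * coefficient (0# ∷ q) m
    shifted zero    = sym (zeroʳ b)
    shifted (suc m) = coefficient-constant-* b q m

  -- Multiplying lists leaves residues such as `+ 0#`, so the power is literally a one-element list,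
  -- but its entry is only `≈` to the expected sign.
  -1ₚ^ : ∀ j → ∃[ s ] (-ₚ constant 1#) ^ₚ j ≡ constant s × s ≈ (- 1#) ^ j
  -1ₚ^ zero    = 1# , ≡.refl , refl
  -1ₚ^ (suc j) with -1ₚ^ j
  ... | s , eq , s≈ = - 1# * s + 0# , cong ((-ₚ constant 1#) *ₚ_) eq , trans (+-identityʳ _) (*-congˡ s≈)

  coefficient-±* : ∀ j q m → coefficient (((-ₚ constant 1#) ^ₚ j) *ₚ q) m ≈ (- 1#) ^ j * coefficient q m
  coefficient-±* j q m with -1ₚ^ j
  ... | s , eq , s≈ = trans (reflexive (cong (λ p → coefficient (p *ₚ q) m) eq))
    (trans (coefficient-constant-* s q m) (*-congʳ s≈))

  -- p multiplies like a + b x, whatever its list of coefficients.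
  Linear : Poly → Carrier → Carrier → Set _
  Linear p a b = ∀ q m → coefficient (p *ₚ q) m ≈ a * coefficient q m + b * coefficient (0# ∷ q) m

  -- First-row expansion with the row and the cofactors as separate arguments: in the polynomial
  -- determinant, the row splits into two parts while the cofactors are replaced by their
  -- coefficients.
  laplace : ∀ {n} → (Fin n → Carrier) → (Fin n → Carrier) → Carrier
  laplace w f = sum (λ j → sgn j * (w j * f j))

  laplace-cong : ∀ {n} (w : Fin n → Carrier) {f g : Fin n → Carrier} → (∀ j → f j ≈ g j) →
                 laplace w f ≈ laplace w g
  laplace-cong w f≈g = sum-cong-≋ λ j → *-congˡ {sgn j} (*-congˡ {w j} (f≈g j))

  laplace-zero : ∀ {n} (w : Fin n → Carrier) → laplace w (λ _ → 0#) ≈ 0#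
  laplace-zero w = sum-zero λ j → z≈0⇒x[yz]≈0 (sgn j) (w j) refl

  laplace-∑ : ∀ {n} {X : Set} (w : Fin n → Carrier) (xs : List X) (f : Fin n → X → Carrier) →
              laplace w (λ j → ∑ xs (f j)) ≈ ∑ xs (λ x → laplace w (λ j → f j x))
  laplace-∑ w []       f = laplace-zero w
  laplace-∑ w (x ∷ xs) f = begin
    laplace w (λ j → f j x + ∑ xs (f j))
      ≈⟨ sum-cong-≋ (λ j → solve 4 (λ s w a b → s :* (w :* (a :+ b)) := s :* (w :* a) :+ s :* (w :* b))
           refl (sgn j) (w j) (f j x) (∑ xs (f j))) ⟩
    sum (λ j → sgn j * (w j * f j x) + sgn j * (w j * ∑ xs (f j)))
      ≈⟨ ∑-distrib-+ (λ j → sgn j * (w j * f j x)) (λ j → sgn j * (w j * ∑ xs (f j))) ⟩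
    laplace w (λ j → f j x) + laplace w (λ j → ∑ xs (f j))
      ≈⟨ +-congˡ (laplace-∑ w xs f) ⟩
    ∑ (x ∷ xs) (λ x → laplace w (λ j → f j x)) ∎

  -- The choice made in the first row mirrors the recursion of `subsets`: a row taken from `N`
  -- leaves all `m` factors of x to the remaining rows, a row taken from `B` leaves one fewer.
  coefficient-detₚ : ∀ {n} m (P : Matrix Poly n) (N B : Matrix Carrier n) →
    (∀ i j → Linear (P i j) (N i j) (B i j)) →
    coefficient (detₚ P) m ≈ ∑ (subsets n m) (λ S → det (mix S N B))
  coefficient-detₚ {zero}  zero    P N B lin = sym (+-identityʳ 1#)
  coefficient-detₚ {zero}  (suc m) P N B lin = refl
  coefficient-detₚ {suc n} m       P N B lin = trans expand (combine m)
    where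
    d : Fin (suc n) → Poly
    d j = detₚ (λ i l → P (suc i) (punchIn j l))
    IH : ∀ m j → coefficient (d j) m ≈
         ∑ (subsets n m) (λ S → det (mix S (minor zero j N) (minor zero j B)))
    IH m j = coefficient-detₚ m (λ i l → P (suc i) (punchIn j l)) (minor zero j N) (minor zero j B)
      (λ i l → lin (suc i) (punchIn j l))
    expand : coefficient (detₚ P) m ≈
             laplace (N zero) (λ j → coefficient (d j) m) + laplace (B zero) (λ j → coefficient (0# ∷ d j) m)
    expand = begin
      coefficient (detₚ P) m
        ≈⟨ coefficient-sum (λ j → ((-ₚ constant 1#) ^ₚ toℕ j) *ₚ (P zero j *ₚ d j)) m ⟩
      sum (λ j → coefficient (((-ₚ constant 1#) ^ₚ toℕ j) *ₚ (P zero j *ₚ d j)) m)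
        ≈⟨ sum-cong-≋ (λ j → trans (coefficient-±* (toℕ j) (P zero j *ₚ d j) m)
             (trans (*-congˡ (lin zero j (d j) m)) (solve 5 (λ s a x b y →
               s :* (a :* x :+ b :* y) := s :* (a :* x) :+ s :* (b :* y)) refl
               (sgn j) (N zero j) (coefficient (d j) m) (B zero j) (coefficient (0# ∷ d j) m)))) ⟩
      sum (λ j → sgn j * (N zero j * coefficient (d j) m) + sgn j * (B zero j * coefficient (0# ∷ d j) m))
        ≈⟨ ∑-distrib-+ (λ j → sgn j * (N zero j * coefficient (d j) m))
                       (λ j → sgn j * (B zero j * coefficient (0# ∷ d j) m)) ⟩
      laplace (N zero) (λ j → coefficient (d j) m) + laplace (B zero) (λ j → coefficient (0# ∷ d j) m) ∎
    rows : ∀ m (w : Fin (suc n) → Carrier) → laplace w (λ j → coefficient (d j) m) ≈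
           ∑ (subsets n m) (λ S → laplace w (λ j → det (mix S (minor zero j N) (minor zero j B))))
    rows m w = trans (laplace-cong w (IH m))
      (laplace-∑ w (subsets n m) (λ j S → det (mix S (minor zero j N) (minor zero j B))))
    combine : ∀ m →
      laplace (N zero) (λ j → coefficient (d j) m) + laplace (B zero) (λ j → coefficient (0# ∷ d j) m) ≈
      ∑ (subsets (suc n) m) (λ S → det (mix S N B))
    -- `0# ∷ d j` is x times `d j`, so its constant coefficient is 0 and no row can come from `B`.
    combine zero    = begin
      laplace (N zero) (λ j → coefficient (d j) zero) + laplace (B zero) (λ _ → 0#)
        ≈⟨ +-cong (rows zero (N zero)) (laplace-zero (B zero)) ⟩
      ∑ (subsets n zero) (λ S → det (mix (outside ∷ S) N B)) + 0#
        ≈⟨ +-identityʳ _ ⟩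
      ∑ (subsets n zero) (λ S → det (mix (outside ∷ S) N B))
        ≈⟨ ∑-subsets-zero n (λ S → det (mix S N B)) ⟨
      ∑ (subsets (suc n) zero) (λ S → det (mix S N B)) ∎
    combine (suc m) = trans (+-cong (rows (suc m) (N zero)) (rows m (B zero)))
      (sym (∑-subsets-suc n m (λ S → det (mix S N B))))

  charMatrix-linear : ∀ {n} (M : Matrix Carrier n) i j →
                      Linear ((x *ₚ 𝟙ₚ i j) +ₚ (-ₚ constant (M i j))) (- M i j) (𝟙 i j)
  charMatrix-linear M i j with does (i Fin.≟ j)
  ... | true  = λ q m → trans
    (coefficient-linear-* _ _ q m)
    (+-cong (*-congʳ (solve 1 (λ a → (con 0 :* con 1 :+ con 0) :+ a := a) refl (- M i j)))
            (*-congʳ (solve 0 (con 1 :* con 1 :+ con 0 := con 1) refl)))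
  ... | false = λ q m → trans
    (coefficient-linear-* _ _ q m)
    (+-congʳ (*-congʳ (+-identityˡ (- M i j))))

  charPoly-coefficient : ∀ {n} (M : Matrix Carrier n) m k → m ℕ.+ k ≡ n →
    coefficient (charPoly M) m ≈ (- 1#) ^ k * ∑ (subsets n k) (λ β → det (M [ β ]))
  charPoly-coefficient {n} M m k m+k≡n = begin
    coefficient (charPoly M) m
      ≈⟨ coefficient-detₚ m _ -M 𝟙 (charMatrix-linear M) ⟩
    ∑ (subsets n m) (λ S → det (mix S -M 𝟙))
      ≈⟨ ∑-cong (subsets n m) (λ S _ → det-mix-𝟙 S -M) ⟩
    ∑ (subsets n m) (λ S → det (-M [ ∁ S ]))
      ≈⟨ ∑-∁ n m k m+k≡n (λ β → det (-M [ β ])) ⟩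
    ∑ (subsets n k) (λ β → det (-M [ β ]))
      ≈⟨ ∑-cong (subsets n k) (λ β β∈ → trans (det-neg (M [ β ]))
           (*-congʳ (reflexive (cong ((- 1#) ^_) (∈-subsets⁻ k β∈))))) ⟩
    ∑ (subsets n k) (λ β → (- 1#) ^ k * det (M [ β ]))
      ≈⟨ ∑-* (subsets n k) ((- 1#) ^ k) (λ β → det (M [ β ])) ⟨
    (- 1#) ^ k * ∑ (subsets n k) (λ β → det (M [ β ])) ∎
    where
    -M : Matrix Carrier n
    -M i j = - M i j

  charPoly-coefficientℤ : ∀ {n} (M : Matrix Carrier n) k →
    coefficientℤ (charPoly M) (+ n ℤ.- + k) ≈ (- 1#) ^ k * ∑ (subsets n k) (λ β → det (M [ β ]))
  charPoly-coefficientℤ {n} M k with ℕ.<-≤-connex n k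
  ... | inj₂ k≤n = trans
    (reflexive (cong (coefficientℤ (charPoly M)) (≡.trans (ℤ.m-n≡m⊖n n k) (ℤ.⊖-≥ k≤n))))
    (charPoly-coefficient M (n ℕ.∸ k) k (ℕ.m∸n+n≡m k≤n))
  -- Both sides vanish: the exponent is negative, where `coefficientℤ` is 0, and there are no
  -- k-subsets.
  ... | inj₁ n<k = begin
    coefficientℤ (charPoly M) (+ n ℤ.- + k)
      ≈⟨ reflexive (cong (coefficientℤ (charPoly M)) (≡.trans (ℤ.m-n≡m⊖n n k) (ℤ.⊖-< n<k))) ⟩
    coefficientℤ (charPoly M) (ℤ.- + (k ℕ.∸ n))
      ≈⟨ negative (k ℕ.∸ n) (ℕ.m<n⇒0<n∸m n<k) ⟩
    0#
      ≈⟨ zeroʳ _ ⟨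
    (- 1#) ^ k * 0#
      ≈⟨ *-congˡ (∑-subsets-empty n<k (λ β → det (M [ β ]))) ⟨
    (- 1#) ^ k * ∑ (subsets n k) (λ β → det (M [ β ])) ∎
    where
    negative : ∀ j → 0 ℕ.< j → coefficientℤ (charPoly M) (ℤ.- + j) ≈ 0#
    negative (suc j) _ = refl

  principalCoefficient : (α : Subset n) → ℕ → Matrix Carrier ∣ ∁ α ∣ → Carrier
  principalCoefficient {n} α k M = coefficientℤ (charPoly M) (+ n ℤ.- + k ℤ.- + ∣ α ∣)

  signedMinorSum : Matrix Carrier n → ℕ → Subset n → Carrier
  signedMinorSum A k α = (- 1#) ^ k * ∑⊆ k (λ β → det (A [ β ])) (∁ α)

  -- M is separated from A [ ∁ α ] because at ℂ the two sides of the equation have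
  -- syntactically different implicit arguments: comparing the characteristic polynomials
  -- directly would unfold the Cauchy proofs of their coefficients.
  principalCoefficient-signedMinorSum : ∀ (A : Matrix Carrier n) α k {M} → M ≡ A [ ∁ α ] →
    principalCoefficient α k M ≈ signedMinorSum A k α
  principalCoefficient-signedMinorSum {n} A α k ≡.refl = begin
    coefficientℤ (charPoly (A [ ∁ α ])) (+ n ℤ.- + k ℤ.- + ∣ α ∣)
      ≈⟨ reflexive (cong (coefficientℤ (charPoly (A [ ∁ α ]))) (n-k-∣α∣≡∣∁α∣-k α k)) ⟩
    coefficientℤ (charPoly (A [ ∁ α ])) (+ ∣ ∁ α ∣ ℤ.- + k)
      ≈⟨ charPoly-coefficientℤ (A [ ∁ α ]) k ⟩
    (- 1#) ^ k * ∑ (subsets ∣ ∁ α ∣ k) (λ γ → det ((A [ ∁ α ]) [ γ ]))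
      ≈⟨ *-congˡ (∑-cong (subsets ∣ ∁ α ∣ k) (λ γ _ → let eq , el = element-embed (∁ α) γ in
           det-cast eq (λ i j → reflexive (cong₂ A (el i) (el j))))) ⟩
    (- 1#) ^ k * ∑ (subsets ∣ ∁ α ∣ k) (λ γ → det (A [ embed (∁ α) γ ]))
      ≈⟨ *-congˡ (∑-embed (∁ α) k (λ β → det (A [ β ]))) ⟩
    signedMinorSum A k α ∎

-- Counting blocks through two points

-- Together with `⊆∁⁅x⁆` and `⊆∁[p∪q]`, this reduces the indicators in `∑⊆` to Boolean expressions
-- in the two memberships, which reduces inclusion-exclusion to a truth table.
⊆∁⊥ : (β : Subset n) → does (β ⊆? ∁ ⊥) ≡ true
⊆∁⊥ β = dec-true (β ⊆? ∁ ⊥) (λ _ → Subset.x∉p⇒x∈∁p Subset.∉⊥)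

⊆∁⁅x⁆ : (β : Subset n) (x : Fin n) → does (β ⊆? ∁ ⁅ x ⁆) ≡ not (does (x ∈? β))
⊆∁⁅x⁆ β x = does-⇔ (mk⇔ to from) (β ⊆? ∁ ⁅ x ⁆) (¬? (x ∈? β))
  where
  to : β ⊆ₛ ∁ ⁅ x ⁆ → ¬ (x ∈ₛ β)
  to β⊆ x∈β = Subset.x∈∁p⇒x∉p (β⊆ x∈β) (Subset.x∈⁅x⁆ x)
  from : ¬ (x ∈ₛ β) → β ⊆ₛ ∁ ⁅ x ⁆
  from x∉β z∈β = Subset.x∉p⇒x∈∁p λ z∈⁅x⁆ →
    x∉β (≡.subst (_∈ₛ β) (Subset.x∈⁅y⁆⇒x≡y x z∈⁅x⁆) z∈β)

⊆∁[p∪q] : (β p q : Subset n) → does (β ⊆? ∁ (p ∪ q)) ≡ does (β ⊆? ∁ p) ∧ does (β ⊆? ∁ q)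
⊆∁[p∪q] β p q = does-⇔ (mk⇔ to from) (β ⊆? ∁ (p ∪ q)) ((β ⊆? ∁ p) ×-dec (β ⊆? ∁ q))
  where
  to : β ⊆ₛ ∁ (p ∪ q) → β ⊆ₛ ∁ p × β ⊆ₛ ∁ q
  to β⊆ = (λ z∈β → Subset.x∉p⇒x∈∁p λ z∈p → Subset.x∈∁p⇒x∉p (β⊆ z∈β) (Subset.x∈p∪q⁺ (inj₁ z∈p)))
        , (λ z∈β → Subset.x∉p⇒x∈∁p λ z∈q → Subset.x∈∁p⇒x∉p (β⊆ z∈β) (Subset.x∈p∪q⁺ (inj₂ z∈q)))
  from : β ⊆ₛ ∁ p × β ⊆ₛ ∁ q → β ⊆ₛ ∁ (p ∪ q)
  from (β⊆∁p , β⊆∁q) z∈β = Subset.x∉p⇒x∈∁p λ z∈p∪q →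
    [ Subset.x∈∁p⇒x∉p (β⊆∁p z∈β) , Subset.x∈∁p⇒x∉p (β⊆∁q z∈β) ]′ (Subset.x∈p∪q⁻ p q z∈p∪q)

∣⁅x⁆∪⁅y⁆∣≡2 : ∀ {n} {x y : Fin n} → x ≢ y → ∣ ⁅ x ⁆ ∪ ⁅ y ⁆ ∣ ≡ 2
∣⁅x⁆∪⁅y⁆∣≡2 {x = zero}  {zero}  x≢y = contradiction ≡.refl x≢y
∣⁅x⁆∪⁅y⁆∣≡2 {x = zero}  {suc y} x≢y =
  cong suc (≡.trans (cong ∣_∣ (Subset.∪-identityˡ ⁅ y ⁆)) (Subset.∣⁅x⁆∣≡1 y))
∣⁅x⁆∪⁅y⁆∣≡2 {x = suc x} {zero}  x≢y =
  cong suc (≡.trans (cong ∣_∣ (Subset.∪-identityʳ ⁅ x ⁆)) (Subset.∣⁅x⁆∣≡1 x))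
∣⁅x⁆∪⁅y⁆∣≡2 {x = suc x} {suc y} x≢y = ∣⁅x⁆∪⁅y⁆∣≡2 (λ x≡y → x≢y (cong suc x≡y))

-- Pascal's rule applied twice: C(v-2, k-2) is the second difference C(v, k) - 2 C(v-1, k) + C(v-2,
-- k).
binomial-second-difference : ∀ v k → 2 ℕ.≤ v → 1 ℕ.≤ k →
  binomial (+ v ℤ.- + 2) (+ k ℤ.- + 2) ℕ.+ ((v ℕ.∸ 1) C k ℕ.+ (v ℕ.∸ 1) C k) ≡
  v C k ℕ.+ (v ℕ.∸ 2) C k
binomial-second-difference (suc (suc w)) (suc k) (ℕ.s≤s (ℕ.s≤s _)) (ℕ.s≤s _) = begin
  B ℕ.+ (suc w C suc k ℕ.+ suc w C suc k)
    ≡⟨ cong (λ z → B ℕ.+ (z ℕ.+ suc w C suc k)) (nCk+nC[k+1]≡[n+1]C[k+1] w k) ⟨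
  B ℕ.+ ((w C k ℕ.+ w C suc k) ℕ.+ suc w C suc k)
    ≡⟨ solve 4 (λ b c d e → b :+ ((c :+ d) :+ e) := ((b :+ c) :+ e) :+ d) ≡.refl
         B (w C k) (w C suc k) (suc w C suc k) ⟩
  (B ℕ.+ w C k) ℕ.+ suc w C suc k ℕ.+ w C suc k
    ≡⟨ cong (λ z → z ℕ.+ suc w C suc k ℕ.+ w C suc k) (first-difference k) ⟩
  suc w C k ℕ.+ suc w C suc k ℕ.+ w C suc k
    ≡⟨ cong (ℕ._+ w C suc k) (nCk+nC[k+1]≡[n+1]C[k+1] (suc w) k) ⟩
  suc (suc w) C suc k ℕ.+ w C suc k ∎
  where
  open ≡.≡-Reasoning
  open ℕ.+-*-Solver
  B = binomial (+ w) (+ suc k ℤ.- + 2)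
  first-difference : ∀ k → binomial (+ w) (+ suc k ℤ.- + 2) ℕ.+ w C k ≡ suc w C k
  -- This is blocks of size 1: the lower index is -1, where `binomial` is 0, as it must be since no
  -- 1-set contains two points.
  first-difference zero    = ≡.refl
  first-difference (suc k) = nCk+nC[k+1]≡[n+1]C[k+1] w k

module BlockCount {c ℓ} (K : CommutativeRing c ℓ) where
  open CommutativeRing K hiding (zero) renaming (_-_ to _⊖_)
  open RawSemiringDefinitions (RawRing.rawSemiring rawRing) using (_^_)
  open SemiringMult semiring using (×-congˡ; ×-homo-+) renaming (_×_ to _·_)
  open GroupProperties +-group using (//-rightDividesʳ)
    renaming (∙-cancelʳ to +-cancelʳ)
  open Determinant K using (-1^n*-1^n≈1)
  open SubsetSum K
  open SemiringSolver commutativeSemiring using (solve; _:=_; _:*_; _:+_; con)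
  open import Relation.Binary.Reasoning.Setoid setoid

  ∑-filter : ∀ {x p} {X : Set x} {P : Pred X p} (P? : Decidable P) y xs →
             ∑ xs (λ x → if does (P? x) then y else 0#) ≈ y * (length (filter P? xs) · 1#)
  ∑-filter P? y []       = sym (zeroʳ y)
  ∑-filter P? y (x ∷ xs) with does (P? x)
  ... | false = trans (+-identityˡ _) (∑-filter P? y xs)
  ... | true  = trans (+-cong (sym (*-identityʳ y)) (∑-filter P? y xs)) (sym (distribˡ y _ _))

  ∑∋ : ℕ → (Subset n → Carrier) → Fin n → Fin n → Carrier
  ∑∋ k f x y = ∑ (subsets _ k) (λ β → if does (x ∈? β) ∧ does (y ∈? β) then f β else 0#)

  -- For each `β`: [x ∈ β][y ∈ β] + [x ∉ β] + [y ∉ β] = 1 + [x ∉ β][y ∉ β]. The identity also holds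
  -- for `x` equal to `y`.
  inclusion-exclusion : ∀ k (f : Subset n → Carrier) x y →
    ∑∋ k f x y + (∑⊆ k f (∁ ⁅ x ⁆) + ∑⊆ k f (∁ ⁅ y ⁆)) ≈
    ∑⊆ k f (∁ ⊥) + ∑⊆ k f (∁ (⁅ x ⁆ ∪ ⁅ y ⁆))
  inclusion-exclusion {n} k f x y = begin
    ∑∋ k f x y + (∑⊆ k f (∁ ⁅ x ⁆) + ∑⊆ k f (∁ ⁅ y ⁆))
      ≈⟨ +-congˡ (∑-+ (subsets n k) _ _) ⟩
    ∑∋ k f x y + ∑ (subsets n k) (λ β → within β (∁ ⁅ x ⁆) + within β (∁ ⁅ y ⁆))
      ≈⟨ ∑-+ (subsets n k) _ _ ⟩
    ∑ (subsets n k) (λ β → (if does (x ∈? β) ∧ does (y ∈? β) then f β else 0#)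
                            + (within β (∁ ⁅ x ⁆) + within β (∁ ⁅ y ⁆)))
      ≈⟨ ∑-cong (subsets n k) (λ β _ → pointwise β) ⟩
    ∑ (subsets n k) (λ β → within β (∁ ⊥) + within β (∁ (⁅ x ⁆ ∪ ⁅ y ⁆)))
      ≈⟨ ∑-+ (subsets n k) _ _ ⟨
    ∑⊆ k f (∁ ⊥) + ∑⊆ k f (∁ (⁅ x ⁆ ∪ ⁅ y ⁆)) ∎
    where
    within : Subset n → Subset n → Carrier
    within β α = if does (β ⊆? α) then f β else 0#
    cases : ∀ p q z → (if p ∧ q then z else 0#) + ((if not p then z else 0#) + (if not q then z else 0#)) ≈
                      z + (if not p ∧ not q then z else 0#)
    cases true  true  z = +-congˡ (+-identityˡ 0#)
    cases true  false z = solve 1 (λ z → con 0 :+ (con 0 :+ z) := z :+ con 0) refl z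
    cases false true  z = solve 1 (λ z → con 0 :+ (z :+ con 0) := z :+ con 0) refl z
    cases false false z = +-identityˡ _
    pointwise : ∀ β → (if does (x ∈? β) ∧ does (y ∈? β) then f β else 0#)
                        + (within β (∁ ⁅ x ⁆) + within β (∁ ⁅ y ⁆)) ≈
                      within β (∁ ⊥) + within β (∁ (⁅ x ⁆ ∪ ⁅ y ⁆))
    pointwise β
      rewrite ⊆∁⊥ β | ⊆∁[p∪q] β ⁅ x ⁆ ⁅ y ⁆ | ⊆∁⁅x⁆ β x | ⊆∁⁅x⁆ β y =
      cases (does (x ∈? β)) (does (y ∈? β)) (f β)

  ∑⊆-1 : ∀ k (α : Subset n) → ∑⊆ k (λ _ → 1#) (∁ α) ≈ ((n ℕ.∸ ∣ α ∣) C k) · 1#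
  ∑⊆-1 k α = trans (sym (∑-embed (∁ α) k (λ _ → 1#)))
    (trans (∑-subsets-1 ∣ ∁ α ∣ k) (×-congˡ (cong (_C k) (Subset.∣∁p∣≡n∸∣p∣ α))))

  -- The size of the union stays unevaluated so as to cover both distinct points, where it is 2, and
  -- coinciding points, where it is 1.
  ∑∋-1 : ∀ k (x y : Fin n) →
    ∑∋ k (λ _ → 1#) x y + (((n ℕ.∸ 1) C k) · 1# + ((n ℕ.∸ 1) C k) · 1#) ≈
    (n C k) · 1# + ((n ℕ.∸ ∣ ⁅ x ⁆ ∪ ⁅ y ⁆ ∣) C k) · 1#
  ∑∋-1 {n} k x y = begin
    ∑∋ k (λ _ → 1#) x y + (((n ℕ.∸ 1) C k) · 1# + ((n ℕ.∸ 1) C k) · 1#)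
      ≈⟨ +-congˡ (+-cong (∑⊆-1′ ⁅ x ⁆ (Subset.∣⁅x⁆∣≡1 x)) (∑⊆-1′ ⁅ y ⁆ (Subset.∣⁅x⁆∣≡1 y))) ⟨
    ∑∋ k (λ _ → 1#) x y + (∑⊆ k (λ _ → 1#) (∁ ⁅ x ⁆) + ∑⊆ k (λ _ → 1#) (∁ ⁅ y ⁆))
      ≈⟨ inclusion-exclusion k (λ _ → 1#) x y ⟩
    ∑⊆ k (λ _ → 1#) (∁ (⊥ {n})) + ∑⊆ k (λ _ → 1#) (∁ (⁅ x ⁆ ∪ ⁅ y ⁆))
      ≈⟨ +-cong (∑⊆-1′ ⊥ (Subset.∣⊥∣≡0 n)) (∑⊆-1 k (⁅ x ⁆ ∪ ⁅ y ⁆)) ⟩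
    (n C k) · 1# + ((n ℕ.∸ ∣ ⁅ x ⁆ ∪ ⁅ y ⁆ ∣) C k) · 1# ∎
    where
    ∑⊆-1′ : ∀ (α : Subset n) {j} → ∣ α ∣ ≡ j → ∑⊆ k (λ _ → 1#) (∁ α) ≈ ((n ℕ.∸ j) C k) · 1#
    ∑⊆-1′ α ≡.refl = ∑⊆-1 k α

  ∑∋-1-distinct : ∀ {k} {x y : Fin n} → 1 ℕ.≤ k → x ≢ y →
    ∑∋ k (λ _ → 1#) x y ≈ binomial (+ n ℤ.- + 2) (+ k ℤ.- + 2) · 1#
  ∑∋-1-distinct {n} {k} {x} {y} 1≤k x≢y = +-cancelʳ (C₁ · 1# + C₁ · 1#) _ _ (begin
    ∑∋ k (λ _ → 1#) x y + (C₁ · 1# + C₁ · 1#)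
      ≈⟨ ∑∋-1 k x y ⟩
    (n C k) · 1# + ((n ℕ.∸ ∣ ⁅ x ⁆ ∪ ⁅ y ⁆ ∣) C k) · 1#
      ≈⟨ +-congˡ (×-congˡ (cong (λ j → (n ℕ.∸ j) C k) card)) ⟩
    (n C k) · 1# + ((n ℕ.∸ 2) C k) · 1#
      ≈⟨ ×-homo-+ 1# (n C k) ((n ℕ.∸ 2) C k) ⟨
    (n C k ℕ.+ (n ℕ.∸ 2) C k) · 1#
      ≈⟨ ×-congˡ (binomial-second-difference n k 2≤n 1≤k) ⟨
    (B ℕ.+ (C₁ ℕ.+ C₁)) · 1#
      ≈⟨ trans (×-homo-+ 1# B (C₁ ℕ.+ C₁)) (+-congˡ (×-homo-+ 1# C₁ C₁)) ⟩
    B · 1# + (C₁ · 1# + C₁ · 1#) ∎)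
    where
    C₁ = (n ℕ.∸ 1) C k
    B = binomial (+ n ℤ.- + 2) (+ k ℤ.- + 2)
    card = ∣⁅x⁆∪⁅y⁆∣≡2 x≢y
    2≤n : 2 ℕ.≤ n
    2≤n = ≡.subst (ℕ._≤ n) card (Subset.∣p∣≤n (⁅ x ⁆ ∪ ⁅ y ⁆))

  -- The same constant `c₁` stands for the coefficients at `x` and at `y`, whence the factor 2. The
  -- sign `s` is its own inverse, so one more multiplication by it removes it.
  second-difference : ∀ {s c₀ c₁ c₂ T₀ Tx Ty T₂ S} → s * s ≈ 1# →
    c₀ ≈ s * T₀ → c₁ ≈ s * Tx → c₁ ≈ s * Ty → c₂ ≈ s * T₂ → S + (Tx + Ty) ≈ T₀ + T₂ →
    s * (c₀ ⊖ 2 · 1# * c₁ + c₂) ≈ S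
  second-difference {s} {c₀} {c₁} {c₂} {T₀} {Tx} {Ty} {T₂} {S} s²≈1 c₀≈ c₁≈x c₁≈y c₂≈ S≈ = begin
    s * D           ≈⟨ *-congˡ D≈sS ⟩
    s * (s * S)     ≈⟨ *-assoc s s S ⟨
    (s * s) * S     ≈⟨ *-congʳ s²≈1 ⟩
    1# * S          ≈⟨ *-identityˡ S ⟩
    S               ∎
    where
    t = 2 · 1# * c₁
    D = c₀ ⊖ t + c₂
    t≈ : t ≈ s * Tx + s * Ty
    t≈ = trans (solve 1 (λ c → (con 1 :+ (con 1 :+ con 0)) :* c := c :+ c) refl c₁) (+-cong c₁≈x c₁≈y)
    D≈sS : D ≈ s * S
    D≈sS = +-cancelʳ t D (s * S) (begin
      c₀ ⊖ t + c₂ + t              ≈⟨ solve 4 (λ a b c d → ((a :+ b) :+ c) :+ d := (a :+ c) :+ (b :+ d))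
                                        refl c₀ (- t) c₂ t ⟩
      (c₀ + c₂) + (- t + t)        ≈⟨ +-congˡ (-‿inverseˡ t) ⟩
      (c₀ + c₂) + 0#               ≈⟨ +-identityʳ _ ⟩
      c₀ + c₂                      ≈⟨ +-cong c₀≈ c₂≈ ⟩
      s * T₀ + s * T₂              ≈⟨ distribˡ s T₀ T₂ ⟨
      s * (T₀ + T₂)                ≈⟨ *-congˡ S≈ ⟨
      s * (S + (Tx + Ty))          ≈⟨ solve 4 (λ s S x y → s :* (S :+ (x :+ y)) := s :* S :+ (s :* x :+ s :* y))
                                        refl s S Tx Ty ⟩
      s * S + (s * Tx + s * Ty)    ≈⟨ +-congˡ t≈ ⟨
      s * S + t                    ∎)

  -- The second hypothesis is S = aL + b(N - L) without subtraction: among `N` sets, `L` have minor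
  -- `a` and the others `b`. Hence (a - b)L = S - bN.
  solve-count : ∀ {a b u S N L} → u * (a ⊖ b) ≈ 1# → S + b * L ≈ b * N + a * L →
                L ≈ u * S ⊖ (b * u) * N
  solve-count {a} {b} {u} {S} {N} {L} u⁻¹ S≈ = begin
    L                                  ≈⟨ //-rightDividesʳ ((b * u) * N) L ⟨
    L + (b * u) * N ⊖ (b * u) * N      ≈⟨ +-congʳ (+-cancelʳ (u * (b * L)) _ _ L+buN) ⟩
    u * S ⊖ (b * u) * N                ∎
    where
    -- The inverse relation freed of its subtraction, in the form that the semiring solver can work
    -- with.
    ua≈1+ub : u * a ≈ 1# + u * b
    ua≈1+ub = begin
      u * a                  ≈⟨ *-congˡ (+-identityʳ a) ⟨
      u * (a + 0#)           ≈⟨ *-congˡ (+-congˡ (-‿inverseˡ b)) ⟨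
      u * (a + (- b + b))    ≈⟨ solve 4 (λ u a m b → u :* (a :+ (m :+ b)) := u :* (a :+ m) :+ u :* b)
                                  refl u a (- b) b ⟩
      u * (a ⊖ b) + u * b    ≈⟨ +-congʳ u⁻¹ ⟩
      1# + u * b             ∎
    L+buN : L + (b * u) * N + u * (b * L) ≈ u * S + u * (b * L)
    L+buN = begin
      L + (b * u) * N + u * (b * L)    ≈⟨ solve 4 (λ L b u N → L :+ (b :* u) :* N :+ u :* (b :* L) :=
                                            u :* (b :* N) :+ (con 1 :+ u :* b) :* L) refl L b u N ⟩
      u * (b * N) + (1# + u * b) * L   ≈⟨ +-congˡ (*-congʳ ua≈1+ub) ⟨
      u * (b * N) + (u * a) * L        ≈⟨ solve 5 (λ u b N a L → u :* (b :* N) :+ (u :* a) :* L :=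
                                            u :* (b :* N :+ a :* L)) refl u b N a L ⟩
      u * (b * N + a * L)              ≈⟨ *-congˡ S≈ ⟨
      u * (S + b * L)                  ≈⟨ distribˡ u S (b * L) ⟩
      u * S + u * (b * L)              ∎

  module _ {p} {H : Pred (Subset n) p} (H? : Decidable H) where

    blocks∋ : ℕ → Fin n → Fin n → List (Subset n)
    blocks∋ k x y = filter (λ β → H? β ×-dec (x ∈? β ×-dec y ∈? β)) (subsets n k)

    module _ {k} {f : Subset n → Carrier} {a b} (f≈a : ∀ β → β List.∈ subsets n k → H β → f β ≈ a)
             (f≈b : ∀ β → β List.∈ subsets n k → ¬ H β → f β ≈ b) where

      -- A block through both points contributes a + b to either side, any other k-set through both
      -- points contributes b, and the remaining sets contribute nothing.
      ∑∋-two-valued : ∀ x y → let L = length (blocks∋ k x y) · 1# in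
        ∑∋ k f x y + b * L ≈ b * ∑∋ k (λ _ → 1#) x y + a * L
      ∑∋-two-valued x y = begin
        ∑∋ k f x y + b * L
          ≈⟨ +-congˡ (∑-filter _ b (subsets n k)) ⟨
        ∑∋ k f x y + ∑ (subsets n k) (λ β → if does (H? β) ∧ both β then b else 0#)
          ≈⟨ ∑-+ (subsets n k) _ _ ⟩
        ∑ (subsets n k) (λ β → (if both β then f β else 0#) + (if does (H? β) ∧ both β then b else 0#))
          ≈⟨ ∑-cong (subsets n k) pointwise ⟩
        ∑ (subsets n k) (λ β → b * (if both β then 1# else 0#) + (if does (H? β) ∧ both β then a else 0#))
          ≈⟨ ∑-+ (subsets n k) _ _ ⟨
        ∑ (subsets n k) (λ β → b * (if both β then 1# else 0#))
          + ∑ (subsets n k) (λ β → if does (H? β) ∧ both β then a else 0#)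
          ≈⟨ +-cong (sym (∑-* (subsets n k) b _)) (∑-filter _ a (subsets n k)) ⟩
        b * ∑∋ k (λ _ → 1#) x y + a * L ∎
        where
        L = length (blocks∋ k x y) · 1#
        both : Subset n → Bool
        both β = does (x ∈? β) ∧ does (y ∈? β)
        pointwise : ∀ β → β List.∈ subsets n k →
          (if both β then f β else 0#) + (if does (H? β) ∧ both β then b else 0#) ≈
          b * (if both β then 1# else 0#) + (if does (H? β) ∧ both β then a else 0#)
        pointwise β β∈ with both β | H? β
        ... | false | yes _  = solve 1 (λ b → con 0 :+ con 0 := b :* con 0 :+ con 0) refl b
        ... | false | no _   = solve 1 (λ b → con 0 :+ con 0 := b :* con 0 :+ con 0) refl b
        ... | true  | yes Hβ = trans (+-congʳ (f≈a β β∈ Hβ))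
          (solve 2 (λ a b → a :+ b := b :* con 1 :+ a) refl a b)
        ... | true  | no ¬Hβ = trans (+-congʳ (f≈b β β∈ ¬Hβ))
          (solve 1 (λ b → b :+ con 0 := b :* con 1 :+ con 0) refl b)

      length-blocks∋ : ∀ {u c₀ c₁ c₂ N x y} → u * (a ⊖ b) ≈ 1# →
        c₀ ≈ (- 1#) ^ k * ∑⊆ k f (∁ ⊥) →
        c₁ ≈ (- 1#) ^ k * ∑⊆ k f (∁ ⁅ x ⁆) → c₁ ≈ (- 1#) ^ k * ∑⊆ k f (∁ ⁅ y ⁆) →
        c₂ ≈ (- 1#) ^ k * ∑⊆ k f (∁ (⁅ x ⁆ ∪ ⁅ y ⁆)) →
        ∑∋ k (λ _ → 1#) x y ≈ N →
        length (blocks∋ k x y) · 1# ≈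
          ((- 1#) ^ k * u) * (c₀ ⊖ 2 · 1# * c₁ + c₂) ⊖ (b * u) * N
      length-blocks∋ {u} {c₀} {c₁} {c₂} {N} {x} {y} u⁻¹ c₀≈ c₁≈x c₁≈y c₂≈ N≈ = begin
        length (blocks∋ k x y) · 1#
          ≈⟨ solve-count u⁻¹ (trans (∑∋-two-valued x y) (+-congʳ (*-congˡ N≈))) ⟩
        u * ∑∋ k f x y ⊖ (b * u) * N
          ≈⟨ +-congʳ (*-congˡ (second-difference (-1^n*-1^n≈1 k) c₀≈ c₁≈x c₁≈y c₂≈
               (inclusion-exclusion k f x y))) ⟨
        u * ((- 1#) ^ k * (c₀ ⊖ 2 · 1# * c₁ + c₂)) ⊖ (b * u) * N
          ≈⟨ +-congʳ (solve 3 (λ u s d → u :* (s :* d) := (s :* u) :* d) refl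
               u ((- 1#) ^ k) (c₀ ⊖ 2 · 1# * c₁ + c₂)) ⟩
        ((- 1#) ^ k * u) * (c₀ ⊖ 2 · 1# * c₁ + c₂) ⊖ (b * u) * N ∎

-- Two-valued minors over a ring in which ℕ embeds

1≤∣α∣⇒nonempty : (α : Subset n) → 1 ≤ ∣ α ∣ → ∃[ x ] x ∈ₛ α
1≤∣α∣⇒nonempty {n} α 1≤∣α∣ with Subset.nonempty? α
... | yes α-nonempty = α-nonempty
... | no  α-empty    = contradiction
  (subst (1 ≤_) (≡.trans (cong ∣_∣ (Subset.Empty-unique α-empty)) (Subset.∣⊥∣≡0 n)) 1≤∣α∣) λ ()

∈⇒1≤length : ∀ {X : Set} {x : X} {xs} → x List.∈ xs → 1 ≤ length xs
∈⇒1≤length {xs = _ ∷ _} _ = s≤s z≤n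

module CharacteristicZero {c} (R : RawRing c 0ℓ) (isCommutativeRing : IsCommutativeRing
  (RawRing._≈_ R) (RawRing._+_ R) (RawRing._*_ R) (RawRing.-_ R) (RawRing.0# R) (RawRing.1# R)) where
  K : CommutativeRing c 0ℓ
  K = record { RawRing R ; isCommutativeRing = isCommutativeRing }
  open CommutativeRing K hiding (zero; isCommutativeRing) renaming (_-_ to _⊖_)
  open SemiringMult semiring using () renaming (_×_ to _·_)
  open SemiringSum semiring using (sum)
  open RawSemiringDefinitions (RawRing.rawSemiring R) using (_^_)
  open SemiringExp semiring using (^-congˡ)
  open GroupProperties +-group using (//-rightDividesʳ)
  open MatrixOps rawRing using (det)
  open CharPoly R isCommutativeRing using (signedMinorSum)
  open BlockCount K
  open import Relation.Binary.Reasoning.Setoid setoid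

  module _ (·1-injective : ∀ {m n} → m · 1# ≈ n · 1# → m ≡ n) where

    1≉0 : ¬ (1# ≈ 0#)
    1≉0 1≈0 = contradiction (·1-injective {1} {0} (trans (+-identityʳ 1#) 1≈0)) λ ()

    bit : Bool → Carrier
    bit c = if c then 1# else 0#

    bit-injective : ∀ {c} → bit c ≈ 1# → c ≡ true
    bit-injective {true}  _   = ≡.refl
    bit-injective {false} 0≈1 = contradiction (sym 0≈1) 1≉0

    count-true : (Fin n → Bool) → ℕ
    count-true {zero}    f = 0
    count-true {suc n} f = (if f Fin.zero then 1 else 0) ℕ.+ count-true (λ i → f (suc i))

    sum-bits : (f : Fin n → Bool) → sum (λ i → bit (f i)) ≈ count-true f · 1#
    sum-bits {zero}    f = refl
    sum-bits {suc n} f with f Fin.zero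
    ... | true  = +-congˡ (sum-bits (λ i → f (suc i)))
    ... | false = trans (+-identityˡ _) (sum-bits (λ i → f (suc i)))

    1≤count-true : (f : Fin n → Bool) → ∀ i → f i ≡ true → 1 ≤ count-true f
    1≤count-true f Fin.zero    fi≡true rewrite fi≡true = s≤s z≤n
    1≤count-true f (Fin.suc i) fi≡true = ℕ.≤-trans (1≤count-true (λ i → f (suc i)) i fi≡true) (ℕ.m≤n+m _ _)

    -- The scheme's axioms are equations between matrices over the ring. Reading a sum of 0s and 1s
    -- as a natural number shows that a pair in relation 0 lies in no other relation.
    sum-bits≈1⇒unique : (f : Fin (suc n) → Bool) → sum (λ i → bit (f i)) ≈ 1# →
                        f Fin.zero ≡ true → ∀ i → f (suc i) ≢ true
    sum-bits≈1⇒unique f sum≈1 f₀ i fᵢ = ℕ.<-irrefl ≡.refl (subst (2 ≤_) count≡1 2≤count)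
      where
      count≡1 : count-true f ≡ 1
      count≡1 = ·1-injective (trans (sym (sum-bits f)) (trans sum≈1 (sym (+-identityʳ 1#))))
      2≤count : 2 ≤ count-true f
      2≤count rewrite f₀ = s≤s (1≤count-true (λ i → f (suc i)) i fᵢ)

    module TwoMinors (A : Matrix Carrier v) (k : ℕ) {a b u} (u⁻¹ : u * (a ⊖ b) ≈ 1#)
      (two-valued : ∀ β → ∣ β ∣ ≡ k → det (A [ β ]) ≈ a ⊎ det (A [ β ]) ≈ b) where

      a≉b : ¬ (a ≈ b)
      a≉b a≈b = 1≉0 (begin
        1#           ≈⟨ u⁻¹ ⟨
        u * (a ⊖ b)  ≈⟨ *-congˡ (+-congʳ a≈b) ⟩
        u * (b ⊖ b)  ≈⟨ *-congˡ (-‿inverseʳ b) ⟩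
        u * 0#       ≈⟨ zeroʳ u ⟩
        0#           ∎)

      Block : Subset v → Set
      Block β = ∣ β ∣ ≡ k × det (A [ β ]) ≈ a

      block? : Decidable Block
      block? β with ∣ β ∣ ℕ.≟ k
      ... | no ∣β∣≢k  = no λ (∣β∣≡k , _) → ∣β∣≢k ∣β∣≡k
      ... | yes ∣β∣≡k with two-valued β ∣β∣≡k
      ...   | inj₁ det≈a = yes (∣β∣≡k , det≈a)
      ...   | inj₂ det≈b = no λ (_ , det≈a) → a≉b (trans (sym det≈a) det≈b)

      ¬block⇒b : ∀ β → β List.∈ subsets v k → ¬ Block β → det (A [ β ]) ≈ b
      ¬block⇒b β β∈ ¬block with two-valued β (∈-subsets⁻ k β∈)
      ... | inj₁ det≈a = contradiction (∈-subsets⁻ k β∈ , det≈a) ¬block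
      ... | inj₂ det≈b = det≈b

      blocks : Fin v → Fin v → List (Subset v)
      blocks = blocks∋ block? k

      block∋? : ∀ x y → Decidable (λ α → Block α × (x ∈ₛ α × y ∈ₛ α))
      block∋? x y α = block? α ×-dec (x Subset.∈? α ×-dec y Subset.∈? α)

      ∈-blocks⁺ : ∀ {x y α} → Block α → x ∈ₛ α → y ∈ₛ α → α List.∈ blocks x y
      ∈-blocks⁺ {x} {y} {α} block x∈α y∈α =
        ∈-filter⁺ (block∋? x y) (∈-subsets⁺ α (proj₁ block)) (block , x∈α , y∈α)

      pairs-cardinality : ∀ x y → HasCardinality (λ α → Block α × (x ∈ₛ α × y ∈ₛ α)) (length (blocks x y))
      pairs-cardinality x y = blocks x y , Unique.filter⁺ (block∋? x y) (subsets-unique v k) , ≡.refl ,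
        λ α → mk⇔ (λ α∈ → proj₂ (∈-filter⁻ (block∋? x y) {xs = subsets v k} α∈))
                  (λ (block , x∈α , y∈α) → ∈-blocks⁺ block x∈α y∈α)

      points-cardinality : ∀ x → HasCardinality (λ α → Block α × x ∈ₛ α) (length (blocks x x))
      points-cardinality x = blocks x x , Unique.filter⁺ (block∋? x x) (subsets-unique v k) , ≡.refl ,
        λ α → mk⇔ (λ α∈ → let block , x∈α , _ = proj₂ (∈-filter⁻ (block∋? x x) {xs = subsets v k} α∈)
                          in block , x∈α)
                  (λ (block , x∈α) → ∈-blocks⁺ block x∈α x∈α)

      module _ {c₀ c₁} (c₀-const : ∀ α → ∣ α ∣ ≡ 0 → c₀ ≈ signedMinorSum A k α)
               (c₁-const : ∀ α → ∣ α ∣ ≡ 1 → c₁ ≈ signedMinorSum A k α) where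

        formula : Carrier → Carrier → Carrier
        formula c₂ N = ((- 1#) ^ k * u) * (c₀ ⊖ 2 · 1# * c₁ + c₂) ⊖ (b * u) * N

        length-blocks : ∀ {x y c₂ N} → c₂ ≈ signedMinorSum A k (⁅ x ⁆ ∪ ⁅ y ⁆) → ∑∋ k (λ _ → 1#) x y ≈ N →
                        length (blocks x y) · 1# ≈ formula c₂ N
        length-blocks {x} {y} c₂≈ N≈ = length-blocks∋ block? (λ _ _ → proj₂) ¬block⇒b u⁻¹
          (c₀-const ⊥ (Subset.∣⊥∣≡0 v))
          (c₁-const ⁅ x ⁆ (Subset.∣⁅x⁆∣≡1 x))
          (c₁-const ⁅ y ⁆ (Subset.∣⁅x⁆∣≡1 y))
          c₂≈ N≈

        length-blocks-distinct : ∀ {x y c₂} → 1 ≤ k → x ≢ y → c₂ ≈ signedMinorSum A k (⁅ x ⁆ ∪ ⁅ y ⁆) →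
          length (blocks x y) · 1# ≈ formula c₂ (binomial (+ v - + 2) (+ k - + 2) · 1#)
        length-blocks-distinct 1≤k x≢y c₂≈ = length-blocks c₂≈ (∑∋-1-distinct 1≤k x≢y)

        -- The operations are variables so that at ℂ the conclusion is literally the
        -- formula for λᵢ; identifying it with its ring form by conversion is infeasible.
        length-blocks-formula :
          {_⊞_ _⊟_ _⊠_ : Carrier → Carrier → Carrier} → (∀ x y → x ⊞ y ≈ x + y) →
          (∀ x y → x ⊟ y ≈ x ⊖ y) → (∀ x y → x ⊠ y ≈ x * y) →
          ∀ {x y c₂ L two N m p q} → 1 ≤ k → x ≢ y → c₂ ≈ signedMinorSum A k (⁅ x ⁆ ∪ ⁅ y ⁆) →
          L ≈ length (blocks x y) · 1# → two ≈ 2 · 1# → N ≈ binomial (+ v - + 2) (+ k - + 2) · 1# →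
          m ≈ - 1# → p ≈ (m ^ k) ⊠ u → q ≈ b ⊠ u →
          L ≈ (p ⊠ ((c₀ ⊟ (two ⊠ c₁)) ⊞ c₂)) ⊟ (q ⊠ N)
        length-blocks-formula {_⊞_} {_⊟_} {_⊠_} ⊞≈ ⊟≈ ⊠≈ {x} {y} {c₂} {L} {two} {N} {m} {p} {q}
          1≤k x≢y c₂≈ L≈ two≈ N≈ m≈ p≈ q≈ = begin
          L
            ≈⟨ L≈ ⟩
          length (blocks x y) · 1#
            ≈⟨ length-blocks-distinct 1≤k x≢y c₂≈ ⟩
          formula c₂ (binomial (+ v - + 2) (+ k - + 2) · 1#)
            ≈⟨ +-cong (*-cong (trans p≈ (trans (⊠≈ (m ^ k) u) (*-congʳ (^-congˡ k m≈))))
                              (+-congʳ (+-congˡ (-‿cong (*-congʳ two≈)))))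
                      (-‿cong (*-cong (trans q≈ (⊠≈ b u)) N≈)) ⟨
          p * (c₀ ⊖ two * c₁ + c₂) ⊖ q * N
            ≈⟨ +-cong (*-congˡ (+-congʳ (+-congˡ (-‿cong (⊠≈ two c₁))))) (-‿cong (⊠≈ q N)) ⟨
          p * (c₀ ⊖ (two ⊠ c₁) + c₂) ⊖ (q ⊠ N)
            ≈⟨ +-congʳ (*-congˡ (+-congʳ (⊟≈ c₀ (two ⊠ c₁)))) ⟨
          p * ((c₀ ⊟ (two ⊠ c₁)) + c₂) ⊖ (q ⊠ N)
            ≈⟨ +-congʳ (*-congˡ (⊞≈ (c₀ ⊟ (two ⊠ c₁)) c₂)) ⟨
          p * ((c₀ ⊟ (two ⊠ c₁)) ⊞ c₂) ⊖ (q ⊠ N)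
            ≈⟨ +-congʳ (⊠≈ p ((c₀ ⊟ (two ⊠ c₁)) ⊞ c₂)) ⟨
          (p ⊠ ((c₀ ⊟ (two ⊠ c₁)) ⊞ c₂)) ⊖ (q ⊠ N)
            ≈⟨ ⊟≈ _ _ ⟨
          (p ⊠ ((c₀ ⊟ (two ⊠ c₁)) ⊞ c₂)) ⊟ (q ⊠ N) ∎

        -- Both lengths have the same expression in the ring, and `·1-injective` carries the
        -- equality down to ℕ.
        length-blocks-pairs : ∀ {x y x′ y′ c₂} → 1 ≤ k → x ≢ y → x′ ≢ y′ →
          c₂ ≈ signedMinorSum A k (⁅ x ⁆ ∪ ⁅ y ⁆) → c₂ ≈ signedMinorSum A k (⁅ x′ ⁆ ∪ ⁅ y′ ⁆) →
          length (blocks x y) ≡ length (blocks x′ y′)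
        length-blocks-pairs 1≤k x≢y x′≢y′ c₂≈ c₂≈′ = ·1-injective (trans
          (length-blocks-distinct 1≤k x≢y c₂≈) (sym (length-blocks-distinct 1≤k x′≢y′ c₂≈′)))

        length-blocks-points : ∀ x x′ → length (blocks x x) ≡ length (blocks x′ x′)
        length-blocks-points x x′ = ·1-injective (trans (single x) (sym (single x′)))
          where
          N₀ N₁ : Carrier
          N₀ = (v C k) · 1#
          N₁ = ((v ℕ.∸ 1) C k) · 1#
          ∣⁅x⁆∪⁅x⁆∣≡1 : ∀ x → ∣ ⁅ x ⁆ ∪ ⁅ x ⁆ ∣ ≡ 1
          ∣⁅x⁆∪⁅x⁆∣≡1 x = ≡.trans (cong ∣_∣ (Subset.∪-idem ⁅ x ⁆)) (Subset.∣⁅x⁆∣≡1 x)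
          single : ∀ x → length (blocks x x) · 1# ≈ formula c₁ ((N₀ + N₁) ⊖ (N₁ + N₁))
          -- The union of a singleton with itself has one element, so `c₁` takes the place of `c₂`.
          -- The number of k-sets through `x` is left as a difference; what matters is that it does
          -- not mention `x`.
          single x = length-blocks (c₁-const (⁅ x ⁆ ∪ ⁅ x ⁆) (∣⁅x⁆∪⁅x⁆∣≡1 x)) (begin
            S                            ≈⟨ //-rightDividesʳ (N₁ + N₁) S ⟨
            (S + (N₁ + N₁)) ⊖ (N₁ + N₁)  ≈⟨ +-congʳ (∑∋-1 k x x) ⟩
            (N₀ + ((v ℕ.∸ ∣ ⁅ x ⁆ ∪ ⁅ x ⁆ ∣) C k) · 1#) ⊖ (N₁ + N₁)
              ≡⟨ cong (λ j → (N₀ + ((v ℕ.∸ j) C k) · 1#) ⊖ (N₁ + N₁)) (∣⁅x⁆∪⁅x⁆∣≡1 x) ⟩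
            (N₀ + N₁) ⊖ (N₁ + N₁)        ∎)
            where S = ∑∋ k (λ _ → 1#) x x

-- Transfer to complex matrices and the association scheme

ℂ-isCommutativeRing : IsCommutativeRing _≈ᶜ_ _+ᶜ_ _*ᶜ_ -ᶜ_ 0ᶜ 1ᶜ
ℂ-isCommutativeRing = CommutativeRing.isCommutativeRing ℂ-commutativeRing

open CommutativeRing ℂ-commutativeRing using () renaming (refl to ≈ᶜ-refl; sym to ≈ᶜ-sym; trans to ≈ᶜ-trans)
open CharPoly ℂ-rawRing ℂ-isCommutativeRing using (signedMinorSum; principalCoefficient-signedMinorSum)

const⇒signedMinorSum : ∀ (A : Matrix ℂ n) α k {c} → coeff A α k ≈ᶜ c → c ≈ᶜ signedMinorSum A k α
const⇒signedMinorSum A α k {c} coeff≈c =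
  ≈ᶜ-trans {c} {coeff A α k} {signedMinorSum A k α} (≈ᶜ-sym {coeff A α k} {c} coeff≈c)
    (principalCoefficient-signedMinorSum A α k {A [ ∁ α ]} ≡.refl)

theorem3p1 : ∀ {v d : ℕ} (𝓧 : AssociationScheme v d) (k : ℕ) → 1 ≤ k →
    (A : Matrix ℂ v) → Diagonalisable A →
    (a b : ℂ) (a#b : a # b) →
    principalMinors A k ≐ pairSet a b →
    (c₀ c₁ : ℂ) (c₂ : Fin d → ℂ) →
    (∀ (α : Subset v) → ∣ α ∣ ≡ 0 → coeff A α k ≈ᶜ c₀) →
    (∀ (α : Subset v) → ∣ α ∣ ≡ 1 → coeff A α k ≈ᶜ c₁) →
    (∀ (j : Fin d) (α : Subset v) →
    α ∈ AssociationScheme.unorderedPairs 𝓧 (suc j) → coeff A α k ≈ᶜ c₂ j) →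
    Σ (Fin d → ℕ) λ lam →
    IsPBIBD 𝓧 k lam (ℌ A k a) ×
    (∀ (i : Fin d) →
    fromℕ (lam i) ≈ᶜ
    ((-ᶜ 1ᶜ) ^ᶜ k ÷ (a -ᶜ b) ⟨ a#b ⟩) *ᶜ (c₀ -ᶜ fromℕ 2 *ᶜ c₁ +ᶜ c₂ i)
    -ᶜ (b ÷ (a -ᶜ b) ⟨ a#b ⟩) *ᶜ fromℕ (binomial (+ v - + 2) (+ k - + 2)))
theorem3p1 {v} {d} 𝓧 k 1≤k A _ a b a#b D c₀ c₁ c₂ c₀-const c₁-const c₂-const =
  lam , record { uniform = λ _ → proj₁ ; 1-design = r , 1≤r , regular ; balanced = balanced } , lam-formula
  where
  open AssociationScheme 𝓧
  open MatrixOps ℂ-rawRing using (det)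
  open CharacteristicZero ℂ-rawRing ℂ-isCommutativeRing

  two-valued : ∀ β → ∣ β ∣ ≡ k → (det (A [ β ]) ≈ᶜ a) ⊎ (det (A [ β ]) ≈ᶜ b)
  two-valued β ∣β∣≡k = proj₁ D {det (A [ β ])} (β , ∣β∣≡k , ≈ᶜ-refl {det (A [ β ])})

  open TwoMinors fromℕ-injective A k {a} {b} {reciprocal (a -ᶜ b) a#b}
    (reciprocal-inverseˡ (a -ᶜ b) a#b) two-valued

  -- A pair (x, x) already lies in `R zero` by `identity`, and `all-ones` leaves room for only one
  -- relation.
  R-distinct : ∀ i {x y} → R (suc i) x y ≡ true → x ≢ y
  R-distinct i {x} Rᵢxx ≡.refl =
    sum-bits≈1⇒unique fromℕ-injective (λ i → R i x x) (all-ones x x) R₀xx i Rᵢxx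
    where
    R₀xx : R Fin.zero x x ≡ true
    R₀xx = bit-injective fromℕ-injective (subst (adjacency (R Fin.zero) x x ≈ᶜ_)
      (cong (λ c → if c then 1ᶜ else 0ᶜ) (dec-true (x Fin.≟ x) ≡.refl)) (identity x x))

  c₀≈ : ∀ α → ∣ α ∣ ≡ 0 → c₀ ≈ᶜ signedMinorSum A k α
  c₀≈ α ∣α∣≡0 = const⇒signedMinorSum A α k {c₀} (c₀-const α ∣α∣≡0)

  c₁≈ : ∀ α → ∣ α ∣ ≡ 1 → c₁ ≈ᶜ signedMinorSum A k α
  c₁≈ α ∣α∣≡1 = const⇒signedMinorSum A α k {c₁} (c₁-const α ∣α∣≡1)

  c₂≈ : ∀ i {x y} → R (suc i) x y ≡ true → c₂ i ≈ᶜ signedMinorSum A k (⁅ x ⁆ ∪ ⁅ y ⁆)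
  c₂≈ i {x} {y} Rᵢxy = const⇒signedMinorSum A (⁅ x ⁆ ∪ ⁅ y ⁆) k {c₂ i}
    (c₂-const i (⁅ x ⁆ ∪ ⁅ y ⁆) (x , y , Rᵢxy , ≡.refl))

  -- The pair supplied by `nonempty` is an arbitrary representative of its relation; `balanced`
  -- shows that every other pair of the relation gives the same count.
  lam : Fin d → ℕ
  lam i = let x , y , _ = nonempty (suc i) in length (blocks x y)

  lam-formula : ∀ i → fromℕ (lam i) ≈ᶜ
    ((-ᶜ 1ᶜ) ^ᶜ k ÷ (a -ᶜ b) ⟨ a#b ⟩) *ᶜ (c₀ -ᶜ fromℕ 2 *ᶜ c₁ +ᶜ c₂ i)
    -ᶜ (b ÷ (a -ᶜ b) ⟨ a#b ⟩) *ᶜ fromℕ (binomial (+ v - + 2) (+ k - + 2))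
  lam-formula i = let x , y , Rᵢxy = nonempty (suc i) in
    length-blocks-formula {c₀} {c₁} c₀≈ c₁≈ {_+ᶜ_} {_-ᶜ_} {_*ᶜ_}
      (λ z w → ≈ᶜ-refl {z +ᶜ w}) (λ z w → ≈ᶜ-refl {z -ᶜ w}) (λ z w → ≈ᶜ-refl {z *ᶜ w})
      {x} {y} {c₂ i} {fromℕ (lam i)} {fromℕ 2} {fromℕ (binomial (+ v - + 2) (+ k - + 2))}
      { -ᶜ 1ᶜ} {(-ᶜ 1ᶜ) ^ᶜ k ÷ (a -ᶜ b) ⟨ a#b ⟩} {b ÷ (a -ᶜ b) ⟨ a#b ⟩}
      1≤k (R-distinct i Rᵢxy) (c₂≈ i Rᵢxy) (≈ᶜ-refl {fromℕ (lam i)}) (≈ᶜ-refl {fromℕ 2})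
      (≈ᶜ-refl {fromℕ (binomial (+ v - + 2) (+ k - + 2))})
      (≈ᶜ-refl { -ᶜ 1ᶜ}) (÷≈*reciprocal ((-ᶜ 1ᶜ) ^ᶜ k) (a -ᶜ b) a#b) (÷≈*reciprocal b (a -ᶜ b) a#b)

  balanced : ∀ i x y → R (suc i) x y ≡ true →
             HasCardinality (λ α → α ∈ ℌ A k a × (x ∈ₛ α × y ∈ₛ α)) (lam i)
  balanced i x y Rᵢxy = let x′ , y′ , Rᵢx′y′ = nonempty (suc i) in subst (HasCardinality _)
    (length-blocks-pairs {c₀} {c₁} c₀≈ c₁≈ {x} {y} {x′} {y′} {c₂ i} 1≤k
      (R-distinct i Rᵢxy) (R-distinct i Rᵢx′y′) (c₂≈ i Rᵢxy) (c₂≈ i Rᵢx′y′))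
    (pairs-cardinality x y)

  -- A 1-design needs a positive replication number. The value `a` is attained as a minor, so there
  -- is a block; since `k` is at least 1 it has a point, and the count at that point is at least 1.
  block : ∃[ α ] α ∈ ℌ A k a
  block = proj₂ D {a} (inj₁ (≈ᶜ-refl {a}))

  point : ∃[ x ] x ∈ₛ proj₁ block
  point = 1≤∣α∣⇒nonempty (proj₁ block) (subst (1 ≤_) (≡.sym (proj₁ (proj₂ block))) 1≤k)

  r : ℕ
  r = length (blocks (proj₁ point) (proj₁ point))

  1≤r : 1 ≤ r
  1≤r = ∈⇒1≤length (∈-blocks⁺ {proj₁ point} {proj₁ point} (proj₂ block) (proj₂ point) (proj₂ point))

  regular : ∀ x → HasCardinality (λ α → α ∈ ℌ A k a × x ∈ₛ α) r
  regular x = subst (HasCardinality _)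
    (length-blocks-points {c₀} {c₁} c₀≈ c₁≈ x (proj₁ point)) (points-cardinality x)
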